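{- Let $P$ and $Q$ be finite naturally labeled posets with $K_P(\mathbf{x}) = K_Q(\mathbf{x})$. Then $\mathrm{anti}_{k,i,j}(P) = \mathrm{anti}_{k,i,j}(Q)$ for all triples $(k,i,j)$ of nonnegative integers.
   Context: A poset $(P,\preceq)$ on ground set $[n]=\{1,\dots,n\}$ is naturally labeled if $x\preceq y$ implies $x\le y$ as integers. For such $P$, the $P$-partition generating function is $K_P(\mathbf{x})=\sum_{\sigma}\prod_{p\in P}x_{\sigma(p)}$, the sum over all maps $\sigma:P\to\mathbb{Z}^+$ with $\sigma(x)\le\sigma(y)$ whenever $x\preceq y$. An order ideal of $P$ is a subset $I$ such that $x\in I$ and $y\preceq x$ imply $y\in I$. For a poset $P$, $\mathrm{anti}_{k,i,j}(P)$ denotes the number of order ideals $I$ of $P$ with $|I|=k$ such that $I$ has exactly $i$ maximal elements and $P\setminus I$ has exactly $j$ minimal elements. -}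

module Defs where

open import Data.Nat using (ℕ; zero; suc)
import Data.Nat as ℕ
open import Data.Bool using (Bool; true; false)
import Data.Bool as Bool
open import Data.Fin using (Fin)
import Data.Fin as Fin
open import Data.Fin.Properties using (all?)
import Data.Fin.Properties as FinP
open import Data.List using (List; []; _∷_; [_]; map; concatMap; filter; length; allFin)
open import Data.Vec using (Vec; lookup) renaming ([] to []ᵥ; _∷_ to _∷ᵥ_)
open import Data.Product using (_×_)
open import Relation.Binary using (Decidable; IsPartialOrder)
open import Relation.Binary.PropositionalEquality using (_≡_)
open import Relation.Nullary.Decidable using (Dec; _×-dec_; _→-dec_)

-- A naturally labeled (finite) poset on ground set [n], represented as Fin n
-- (element i : Fin n stands for the label toℕ i + 1).
record NLPoset (n : ℕ) : Set₁ where
  field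
    _≼_            : Fin n → Fin n → Set
    isPartialOrder : IsPartialOrder _≡_ _≼_
    _≼?_           : Decidable _≼_
    natural        : ∀ {x y} → x ≼ y → x Fin.≤ y

open NLPoset public

countFin : ∀ {n} {P : Fin n → Set} → (∀ x → Dec (P x)) → ℕ
countFin {n} P? = length (filter P? (allFin n))

allVecs : ∀ {A : Set} (n : ℕ) → List A → List (Vec A n)
allVecs zero    xs = [ []ᵥ ]
allVecs (suc n) xs = concatMap (λ x → map (x ∷ᵥ_) (allVecs n xs)) xs

IsPPartition : ∀ {n r} → NLPoset n → Vec (Fin r) n → Set
IsPPartition P σ = ∀ x y → _≼_ P x y → lookup σ x Fin.≤ lookup σ y

isPPartition? : ∀ {n r} (P : NLPoset n) (σ : Vec (Fin r) n) → Dec (IsPPartition P σ)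
isPPartition? P σ = all? λ x → all? λ y → _≼?_ P x y →-dec (lookup σ x Fin.≤? lookup σ y)

HasContent : ∀ {n r} → (Fin r → ℕ) → Vec (Fin r) n → Set
HasContent a σ = ∀ c → countFin (λ x → lookup σ x FinP.≟ c) ≡ a c

hasContent? : ∀ {n r} (a : Fin r → ℕ) (σ : Vec (Fin r) n) → Dec (HasContent a σ)
hasContent? a σ = all? λ c → countFin (λ x → lookup σ x FinP.≟ c) ℕ.≟ a c

-- coefficient of the monomial x_1^{a_1} ⋯ x_r^{a_r} in K_P(x)
coeffK : ∀ {n r} → NLPoset n → (Fin r → ℕ) → ℕ
coeffK {n} {r} P a =
  length (filter (λ σ → isPPartition? P σ ×-dec hasContent? a σ) (allVecs n (allFin r)))

-- K_P = K_Q as formal power series: all monomial coefficients agree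
-- (every monomial involves only finitely many variables x_1,…,x_r).
SameK : ∀ {n m} → NLPoset n → NLPoset m → Set
SameK P Q = ∀ r (a : Fin r → ℕ) → coeffK P a ≡ coeffK Q a

_∈ₛ_ : ∀ {n} → Fin n → Vec Bool n → Set
x ∈ₛ I = lookup I x ≡ true

_∉ₛ_ : ∀ {n} → Fin n → Vec Bool n → Set
x ∉ₛ I = lookup I x ≡ false

IsOrderIdeal : ∀ {n} → NLPoset n → Vec Bool n → Set
IsOrderIdeal P I = ∀ x y → x ∈ₛ I → _≼_ P y x → y ∈ₛ I

isOrderIdeal? : ∀ {n} (P : NLPoset n) (I : Vec Bool n) → Dec (IsOrderIdeal P I)
isOrderIdeal? P I = all? λ x → all? λ y →
  (lookup I x Bool.≟ true) →-dec (_≼?_ P y x →-dec (lookup I y Bool.≟ true))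

IsMaxIn : ∀ {n} → NLPoset n → Vec Bool n → Fin n → Set
IsMaxIn P I x = x ∈ₛ I × (∀ y → y ∈ₛ I → _≼_ P x y → y ≡ x)

isMaxIn? : ∀ {n} (P : NLPoset n) (I : Vec Bool n) (x : Fin n) → Dec (IsMaxIn P I x)
isMaxIn? P I x = (lookup I x Bool.≟ true) ×-dec all? λ y →
  (lookup I y Bool.≟ true) →-dec (_≼?_ P x y →-dec (y FinP.≟ x))

IsMinOutside : ∀ {n} → NLPoset n → Vec Bool n → Fin n → Set
IsMinOutside P I x = x ∉ₛ I × (∀ y → y ∉ₛ I → _≼_ P y x → y ≡ x)

isMinOutside? : ∀ {n} (P : NLPoset n) (I : Vec Bool n) (x : Fin n) → Dec (IsMinOutside P I x)
isMinOutside? P I x = (lookup I x Bool.≟ false) ×-dec all? λ y →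
  (lookup I y Bool.≟ false) →-dec (_≼?_ P y x →-dec (y FinP.≟ x))

size : ∀ {n} → Vec Bool n → ℕ
size I = countFin (λ x → lookup I x Bool.≟ true)

anti : ∀ {n} → NLPoset n → ℕ → ℕ → ℕ → ℕ
anti {n} P k i j = length (filter
  (λ I → isOrderIdeal? P I
         ×-dec (size I ℕ.≟ k)
         ×-dec (countFin (isMaxIn? P I) ℕ.≟ i)
         ×-dec (countFin (isMinOutside? P I) ℕ.≟ j))
  (allVecs n (true ∷ false ∷ [])))

{-# OPTIONS --safe #-}

-- The coefficients of K_P count chains ∅ ⊆ I₁ ⊆ ⋯ ⊆ P of order ideals with prescribed layer sizes,
-- namely the sublevel sets of a P-partition. Consider functions f on ideals, one for P and one for Q,
-- whose sums over all such chains ending in an argument of f agree. This relation is closed under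
-- linear combinations and under the summation operator Up over larger ideals. It is also closed
-- under Anti, which sums only over those K ⊇ I for which K ∖ I consists of minimal elements of P ∖ I:
-- the alternating sum over the subsets of a nonempty set vanishes, so up to signs Anti is inverse to
-- Up, and Anti on one level is found by triangular inversion from the lower levels. Adding t minimal
-- elements to I and removing s maximal elements from it are instances of Anti, which gives the sums
-- of C(#max I, s) C(#min (P ∖ I), t) over ideals of size k; inverting the binomials gives anti.
module Submission where

open import Defs
open import Data.Nat using (ℕ; zero; suc)
import Data.Nat as ℕ
import Data.Nat.Properties as ℕP
import Data.Nat.Induction as ℕI
open import Data.Nat.Combinatorics using (_C_; nCn≡1; k>n⇒nCk≡0; nCk+nC[k+1]≡[n+1]C[k+1])
open import Data.Integer using (ℤ; _+_; _*_; -_; 0ℤ; 1ℤ) renaming (+_ to pos)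
import Data.Integer.Properties as ℤP
open import Algebra.Properties.AbelianGroup ℤP.+-0-abelianGroup using (∙-cancelʳ)
open import Data.Integer.Tactic.RingSolver using (solve-∀)
open import Data.Bool using (Bool; true; false; if_then_else_)
import Data.Bool as Bool
open import Data.Fin using (Fin; zero; suc; toℕ)
import Data.Fin as Fin
import Data.Fin.Properties as FinP
import Data.Fin.Induction as FinI
open import Data.List using (List; []; _∷_; [_]; _++_; map; concatMap; filter; length; tabulate; allFin; upTo)
import Data.List as List
import Data.List.Properties as ListP
open import Data.Nat.ListAction using (sum)
open import Data.List.Membership.Propositional using (_∈_)
open import Data.List.Membership.Propositional.Properties using (∈-upTo⁺; ∈-upTo⁻)
open import Data.List.Relation.Unary.Any using (here; there)
import Data.List.Relation.Unary.All as All
open import Data.List.Relation.Unary.AllPairs using (_∷_)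
open import Data.List.Relation.Unary.Unique.Propositional using (Unique)
open import Data.List.Relation.Unary.Unique.Propositional.Properties using (upTo⁺)
open import Data.Vec using (Vec; lookup; replicate; zipWith) renaming ([] to []ᵥ; _∷_ to _∷ᵥ_; map to mapᵥ)
import Data.Vec.Properties as VecP
import Data.Vec.Relation.Binary.Pointwise.Extensional as Ext
open import Data.Product using (_×_; _,_; proj₁; proj₂)
open import Data.Sum using (_⊎_; inj₁; inj₂)
import Data.Sum as Sum
open import Function using (_∘_; id)
open import Induction.WellFounded using (Acc; acc)
open import Relation.Binary using (tri<; tri≈; tri>)
open import Relation.Binary.PropositionalEquality hiding ([_])
open import Relation.Nullary using (¬_; Dec; yes; no; does; contradiction)
open import Relation.Nullary.Decidable using (_×-dec_; _→-dec_; _⊎-dec_; ¬?)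

open ≡-Reasoning

-- Finite sums and indicators

∑ : ∀ {A : Set} → List A → (A → ℤ) → ℤ
∑ []       f = 0ℤ
∑ (x ∷ xs) f = f x + ∑ xs f

∑-cong-∈ : ∀ {A : Set} (xs : List A) {f g : A → ℤ} → (∀ x → x ∈ xs → f x ≡ g x) → ∑ xs f ≡ ∑ xs g
∑-cong-∈ []       h = refl
∑-cong-∈ (x ∷ xs) h = cong₂ _+_ (h x (here refl)) (∑-cong-∈ xs (λ y → h y ∘ there))

∑-cong : ∀ {A : Set} (xs : List A) {f g : A → ℤ} → (∀ x → f x ≡ g x) → ∑ xs f ≡ ∑ xs g
∑-cong xs h = ∑-cong-∈ xs (λ x _ → h x)

∑-zero : ∀ {A : Set} (xs : List A) {f : A → ℤ} → (∀ x → f x ≡ 0ℤ) → ∑ xs f ≡ 0ℤ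
∑-zero []       h = refl
∑-zero (x ∷ xs) h = cong₂ _+_ (h x) (∑-zero xs h)

∑-+ : ∀ {A : Set} (xs : List A) (f g : A → ℤ) → ∑ xs (λ x → f x + g x) ≡ ∑ xs f + ∑ xs g
∑-+ []       f g = refl
∑-+ (x ∷ xs) f g = trans (cong ((f x + g x) +_) (∑-+ xs f g)) (interchange (f x) (g x) (∑ xs f) (∑ xs g))
  where
  interchange : ∀ a b c d → (a + b) + (c + d) ≡ (a + c) + (b + d)
  interchange = solve-∀

∑-*ˡ : ∀ {A : Set} (xs : List A) (c : ℤ) (f : A → ℤ) → ∑ xs (λ x → c * f x) ≡ c * ∑ xs f
∑-*ˡ []       c f = sym (ℤP.*-zeroʳ c)
∑-*ˡ (x ∷ xs) c f = trans (cong (c * f x +_) (∑-*ˡ xs c f)) (sym (ℤP.*-distribˡ-+ c (f x) (∑ xs f)))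

∑-*ʳ : ∀ {A : Set} (xs : List A) (f : A → ℤ) (c : ℤ) → ∑ xs (λ x → f x * c) ≡ ∑ xs f * c
∑-*ʳ []       f c = refl
∑-*ʳ (x ∷ xs) f c = trans (cong (f x * c +_) (∑-*ʳ xs f c)) (sym (ℤP.*-distribʳ-+ c (f x) (∑ xs f)))

∑-swap : ∀ {A B : Set} (xs : List A) (ys : List B) (f : A → B → ℤ) →
  ∑ xs (λ x → ∑ ys (f x)) ≡ ∑ ys (λ y → ∑ xs (λ x → f x y))
∑-swap []       ys f = sym (∑-zero ys (λ _ → refl))
∑-swap (x ∷ xs) ys f = trans (cong (∑ ys (f x) +_) (∑-swap xs ys f))
                             (sym (∑-+ ys (f x) (λ y → ∑ xs (λ x → f x y))))

∑-linear : ∀ {A B : Set} (xs : List A) (ys : List B) (c : B → ℤ) (f : A → B → ℤ) →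
  ∑ ys (λ y → c y * ∑ xs (λ x → f x y)) ≡ ∑ xs (λ x → ∑ ys (λ y → c y * f x y))
∑-linear xs ys c f = trans (∑-cong ys (λ y → sym (∑-*ˡ xs (c y) (λ x → f x y))))
                           (∑-swap ys xs (λ y x → c y * f x y))

∑-++ : ∀ {A : Set} (xs ys : List A) (f : A → ℤ) → ∑ (xs ++ ys) f ≡ ∑ xs f + ∑ ys f
∑-++ []       ys f = sym (ℤP.+-identityˡ _)
∑-++ (x ∷ xs) ys f = trans (cong (f x +_) (∑-++ xs ys f)) (sym (ℤP.+-assoc (f x) _ _))

∑-map : ∀ {A B : Set} (h : A → B) (xs : List A) (f : B → ℤ) → ∑ (map h xs) f ≡ ∑ xs (f ∘ h)
∑-map h []       f = refl
∑-map h (x ∷ xs) f = cong (f (h x) +_) (∑-map h xs f)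

∑-concatMap : ∀ {A B : Set} (h : A → List B) (xs : List A) (f : B → ℤ) →
  ∑ (concatMap h xs) f ≡ ∑ xs (λ x → ∑ (h x) f)
∑-concatMap h []       f = refl
∑-concatMap h (x ∷ xs) f = trans (∑-++ (h x) (concatMap h xs) f) (cong (∑ (h x) f +_) (∑-concatMap h xs f))

∑-tabulate : ∀ {A : Set} {n} (h : Fin n → A) (f : A → ℤ) → ∑ (tabulate h) f ≡ ∑ (allFin n) (f ∘ h)
∑-tabulate {n = zero}  h f = refl
∑-tabulate {n = suc n} h f = cong (f (h zero) +_)
  (trans (∑-tabulate (h ∘ suc) f) (sym (∑-tabulate suc (f ∘ h))))

∑-single : ∀ {A : Set} {xs : List A} {x} (f : A → ℤ) → Unique xs → x ∈ xs →
  (∀ y → y ≢ x → f y ≡ 0ℤ) → ∑ xs f ≡ f x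
∑-single {xs = x ∷ xs} f (x∉xs ∷ _) (here refl) h = trans
  (cong (f x +_) (trans (∑-cong-∈ xs (λ y y∈xs → h y (≢-sym (All.lookup x∉xs y∈xs)))) (∑-zero xs (λ _ → refl))))
  (ℤP.+-identityʳ (f x))
∑-single {xs = z ∷ xs} {x} f (z∉xs ∷ u) (there x∈xs) h = trans
  (cong₂ _+_ (h z (All.lookup z∉xs x∈xs)) (∑-single f u x∈xs h))
  (ℤP.+-identityˡ (f x))

∑-allVecs-suc : ∀ {A : Set} (xs : List A) n (f : Vec A (suc n) → ℤ) →
  ∑ (allVecs (suc n) xs) f ≡ ∑ xs (λ x → ∑ (allVecs n xs) (λ v → f (x ∷ᵥ v)))
∑-allVecs-suc xs n f = trans (∑-concatMap (λ x → map (x ∷ᵥ_) (allVecs n xs)) xs f)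
  (∑-cong xs (λ x → ∑-map (x ∷ᵥ_) (allVecs n xs) f))

*-exchange : ∀ a b c → a * (b * c) ≡ b * (a * c)
*-exchange = solve-∀

⟦_⟧ : ∀ {A : Set} → Dec A → ℤ
⟦ d ⟧ = if does d then 1ℤ else 0ℤ

⟦⟧-yes : ∀ {A : Set} (d : Dec A) → A → ⟦ d ⟧ ≡ 1ℤ
⟦⟧-yes (yes _) a = refl
⟦⟧-yes (no ¬a) a = contradiction a ¬a

⟦⟧-no : ∀ {A : Set} (d : Dec A) → ¬ A → ⟦ d ⟧ ≡ 0ℤ
⟦⟧-no (yes a) ¬a = contradiction a ¬a
⟦⟧-no (no _)  ¬a = refl

-- The values are compared only where the condition holds, so a summand can be rewritten with the
-- ideal property or size equation recorded in its own indicator.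
⟦⟧*-cong : ∀ {A B : Set} (d : Dec A) (e : Dec B) {x y : ℤ} →
  (A → B) → (B → A) → (A → x ≡ y) → ⟦ d ⟧ * x ≡ ⟦ e ⟧ * y
⟦⟧*-cong (yes a) (yes b) f g h = cong (1ℤ *_) (h a)
⟦⟧*-cong (yes a) (no ¬b) f g h = contradiction (f a) ¬b
⟦⟧*-cong (no ¬a) (yes b) f g h = contradiction (g b) ¬a
⟦⟧*-cong (no ¬a) (no ¬b) f g h = refl

⟦⟧-cong : ∀ {A B : Set} (d : Dec A) (e : Dec B) → (A → B) → (B → A) → ⟦ d ⟧ ≡ ⟦ e ⟧
⟦⟧-cong (yes a) e f g = sym (⟦⟧-yes e (f a))
⟦⟧-cong (no ¬a) e f g = sym (⟦⟧-no e (¬a ∘ g))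

⟦⟧*-yes : ∀ {A : Set} (d : Dec A) {x : ℤ} → A → ⟦ d ⟧ * x ≡ x
⟦⟧*-yes d {x} a = trans (cong (_* x) (⟦⟧-yes d a)) (ℤP.*-identityˡ x)

⟦⟧*-zero : ∀ {A : Set} (d : Dec A) {x : ℤ} → (A → x ≡ 0ℤ) → ⟦ d ⟧ * x ≡ 0ℤ
⟦⟧*-zero (yes a) h = cong (1ℤ *_) (h a)
⟦⟧*-zero (no ¬a) h = refl

⟦⟧-× : ∀ {A B : Set} (d : Dec A) (e : Dec B) → ⟦ d ×-dec e ⟧ ≡ ⟦ d ⟧ * ⟦ e ⟧
⟦⟧-× (yes a) (yes b) = refl
⟦⟧-× (yes a) (no ¬b) = refl
⟦⟧-× (no ¬a) e       = refl

∑-upTo-select : ∀ {N} x (h : ℕ → ℤ) → x ℕ.< N → ∑ (upTo N) (λ k → ⟦ x ℕ.≟ k ⟧ * h k) ≡ h x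
∑-upTo-select {N} x h x<N = trans
  (∑-single _ (upTo⁺ N) (∈-upTo⁺ x<N) (λ k k≢x → ⟦⟧*-zero (x ℕ.≟ k) (λ x≡k → contradiction (sym x≡k) k≢x)))
  (⟦⟧*-yes (x ℕ.≟ x) refl)

-- Counting

length-filter : ∀ {A : Set} {P : A → Set} (P? : ∀ x → Dec (P x)) (xs : List A) →
  pos (length (filter P? xs)) ≡ ∑ xs (λ x → ⟦ P? x ⟧)
length-filter P? [] = refl
length-filter P? (x ∷ xs) with P? x
... | yes _ = cong (λ z → 1ℤ + z) (length-filter P? xs)
... | no  _ = trans (length-filter P? xs) (sym (ℤP.+-identityˡ _))

count-∑ : ∀ {n} {P : Fin n → Set} (P? : ∀ x → Dec (P x)) → pos (countFin P?) ≡ ∑ (allFin n) (λ x → ⟦ P? x ⟧)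
count-∑ {n} P? = length-filter P? (allFin n)

bit : ∀ {A : Set} → Dec A → ℕ
bit d = if does d then 1 else 0

bit-+ : ∀ {A : Set} (d : Dec A) → pos (bit d) ≡ ⟦ d ⟧
bit-+ (yes _) = refl
bit-+ (no _)  = refl

count-suc : ∀ {n} {P : Fin (suc n) → Set} (P? : ∀ x → Dec (P x)) →
  countFin P? ≡ bit (P? zero) ℕ.+ countFin (P? ∘ suc)
count-suc {n} P? = ℤP.+-injective (begin
  pos (countFin P?)                                          ≡⟨ count-∑ P? ⟩
  ⟦ P? zero ⟧ + ∑ (tabulate suc) (λ x → ⟦ P? x ⟧)         ≡⟨ cong₂ _+_ (bit-+ (P? zero)) (sym (∑-tabulate suc (λ x → ⟦ P? x ⟧))) ⟨
  pos (bit (P? zero)) + ∑ (allFin n) (λ x → ⟦ P? (suc x) ⟧)   ≡⟨ cong (pos (bit (P? zero)) +_) (count-∑ (P? ∘ suc)) ⟨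
  pos (bit (P? zero) ℕ.+ countFin (P? ∘ suc))              ∎)

count-cong : ∀ {n} {P Q : Fin n → Set} (P? : ∀ x → Dec (P x)) (Q? : ∀ x → Dec (Q x)) →
  (∀ x → P x → Q x) → (∀ x → Q x → P x) → countFin P? ≡ countFin Q?
count-cong {n} P? Q? f g = ℤP.+-injective (trans (count-∑ P?) (trans
  (∑-cong (allFin n) (λ x → ⟦⟧-cong (P? x) (Q? x) (f x) (g x))) (sym (count-∑ Q?))))

count-⊎ : ∀ {n} {P Q R : Fin n → Set}
  (P? : ∀ x → Dec (P x)) (Q? : ∀ x → Dec (Q x)) (R? : ∀ x → Dec (R x)) →
  (∀ x → R x → P x ⊎ Q x) → (∀ x → P x → R x) → (∀ x → Q x → R x) → (∀ x → P x → ¬ Q x) →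
  countFin R? ≡ countFin P? ℕ.+ countFin Q?
count-⊎ {n} P? Q? R? split l r disjoint = ℤP.+-injective (begin
  pos (countFin R?)                                        ≡⟨ count-∑ R? ⟩
  ∑ (allFin n) (λ x → ⟦ R? x ⟧)                         ≡⟨ ∑-cong (allFin n) pointwise ⟩
  ∑ (allFin n) (λ x → ⟦ P? x ⟧ + ⟦ Q? x ⟧)               ≡⟨ ∑-+ (allFin n) _ _ ⟩
  ∑ (allFin n) (λ x → ⟦ P? x ⟧) + ∑ (allFin n) (λ x → ⟦ Q? x ⟧) ≡⟨ cong₂ _+_ (count-∑ P?) (count-∑ Q?) ⟨
  pos (countFin P? ℕ.+ countFin Q?)                      ∎)
  where
  pointwise : ∀ x → ⟦ R? x ⟧ ≡ ⟦ P? x ⟧ + ⟦ Q? x ⟧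
  pointwise x with P? x | Q? x
  ... | yes p | yes q = contradiction q (disjoint x p)
  ... | yes p | no _  = ⟦⟧-yes (R? x) (l x p)
  ... | no _  | yes q = ⟦⟧-yes (R? x) (r x q)
  ... | no ¬p | no ¬q = ⟦⟧-no (R? x) λ rx → Sum.[ ¬p , ¬q ] (split x rx)

count≤n : ∀ {n} {P : Fin n → Set} (P? : ∀ x → Dec (P x)) → countFin P? ℕ.≤ n
count≤n {n} P? = subst (countFin P? ℕ.≤_) (ListP.length-tabulate id) (ListP.length-filter P? (allFin n))

count-zero : ∀ {n} {P : Fin n → Set} (P? : ∀ x → Dec (P x)) → (∀ x → ¬ P x) → countFin P? ≡ 0
count-zero {n} P? h = ℤP.+-injective (trans (count-∑ P?) (∑-zero (allFin n) (λ x → ⟦⟧-no (P? x) (h x))))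

count-zero⁻ : ∀ {n} {P : Fin n → Set} (P? : ∀ x → Dec (P x)) → countFin P? ≡ 0 → ∀ x → ¬ P x
count-zero⁻ {suc n} P? eq zero p with P? zero | trans (sym (count-suc P?)) eq
... | yes _ | ()
... | no ¬p | _ = ¬p p
count-zero⁻ {suc n} P? eq (suc x) p =
  count-zero⁻ (P? ∘ suc) (ℕP.m+n≡0⇒n≡0 (bit (P? zero)) (trans (sym (count-suc P?)) eq)) x p

size-∷ : ∀ {n} b (I : Vec Bool n) → size (b ∷ᵥ I) ≡ (if b then 1 else 0) ℕ.+ size I
size-∷ true  I = count-suc (λ x → lookup (true ∷ᵥ I) x Bool.≟ true)
size-∷ false I = count-suc (λ x → lookup (false ∷ᵥ I) x Bool.≟ true)

-- Subsets of the ground set and their sizes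

_⊆_ : ∀ {n} → Vec Bool n → Vec Bool n → Set
I ⊆ L = ∀ x → x ∈ₛ I → x ∈ₛ L

_⊆?_ : ∀ {n} (I L : Vec Bool n) → Dec (I ⊆ L)
I ⊆? L = FinP.all? λ x → (lookup I x Bool.≟ true) →-dec (lookup L x Bool.≟ true)

∉ₛ⇒∉ : ∀ {n} (I : Vec Bool n) {x} → x ∉ₛ I → ¬ (x ∈ₛ I)
∉ₛ⇒∉ I e e' with trans (sym e) e'
... | ()

⊆-antisym : ∀ {n} (I L : Vec Bool n) → I ⊆ L → L ⊆ I → I ≡ L
⊆-antisym I L f g = Ext.Pointwise-≡⇒≡ (Ext.ext pointwise)
  where
  pointwise : ∀ x → lookup I x ≡ lookup L x
  pointwise x with lookup I x in eqI | lookup L x in eqL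
  ... | true  | true  = refl
  ... | false | false = refl
  ... | true  | false = trans (sym (f x eqI)) eqL
  ... | false | true  = trans (sym eqI) (g x eqL)

size-∖ : ∀ {n} (I L : Vec Bool n) → I ⊆ L →
  size L ≡ size I ℕ.+ countFin (λ x → (lookup L x Bool.≟ true) ×-dec (lookup I x Bool.≟ false))
size-∖ I L I⊆L = count-⊎
  (λ x → lookup I x Bool.≟ true) (λ x → (lookup L x Bool.≟ true) ×-dec (lookup I x Bool.≟ false))
  (λ x → lookup L x Bool.≟ true) split I⊆L (λ _ → proj₁) (λ x x∈I (_ , x∉I) → ∉ₛ⇒∉ I x∉I x∈I)
  where
  split : ∀ x → x ∈ₛ L → x ∈ₛ I ⊎ (x ∈ₛ L × x ∉ₛ I)
  split x x∈L with lookup I x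
  ... | true  = inj₁ refl
  ... | false = inj₂ (x∈L , refl)

size-mono : ∀ {n} (I L : Vec Bool n) → I ⊆ L → size I ℕ.≤ size L
size-mono I L I⊆L = subst (size I ℕ.≤_) (sym (size-∖ I L I⊆L)) (ℕP.m≤m+n _ _)

size-≡⇒≡ : ∀ {n} (I L : Vec Bool n) → I ⊆ L → size I ≡ size L → I ≡ L
size-≡⇒≡ I L I⊆L eq = ⊆-antisym I L I⊆L λ x x∈L → back x x∈L
  where
  none = count-zero⁻ (λ x → (lookup L x Bool.≟ true) ×-dec (lookup I x Bool.≟ false))
    (ℕP.+-cancelˡ-≡ (size I) _ 0 (trans (sym (size-∖ I L I⊆L)) (trans (sym eq) (sym (ℕP.+-identityʳ _)))))
  back : ∀ x → x ∈ₛ L → x ∈ₛ I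
  back x x∈L with lookup I x in e
  ... | true  = refl
  ... | false = contradiction (x∈L , e) (none x)

∅ ⊤ₛ : ∀ {n} → Vec Bool n
∅ {n} = replicate n false
⊤ₛ {n} = replicate n true

x∉∅ : ∀ {n} (x : Fin n) → ¬ (x ∈ₛ ∅)
x∉∅ x x∈∅ with trans (sym x∈∅) (VecP.lookup-replicate x false)
... | ()

x∈⊤ : ∀ {n} (x : Fin n) → x ∈ₛ ⊤ₛ
x∈⊤ x = VecP.lookup-replicate x true

size-∅ : ∀ {n} → size (∅ {n}) ≡ 0
size-∅ {n} = count-zero (λ x → lookup (∅ {n}) x Bool.≟ true) x∉∅

-- Sums over intervals of the Boolean lattice

𝒫 : ∀ n → List (Vec Bool n)
𝒫 n = allVecs n (true ∷ false ∷ [])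

∑-𝒫-suc : ∀ n (f : Vec Bool (suc n) → ℤ) →
  ∑ (𝒫 (suc n)) f ≡ ∑ (𝒫 n) (λ I → f (true ∷ᵥ I)) + ∑ (𝒫 n) (λ I → f (false ∷ᵥ I))
∑-𝒫-suc n f = trans (∑-allVecs-suc (true ∷ false ∷ []) n f)
  (cong (∑ (𝒫 n) (λ I → f (true ∷ᵥ I)) +_) (ℤP.+-identityʳ _))

∑-𝒫-single : ∀ {n} (I : Vec Bool n) (f : Vec Bool n → ℤ) → (∀ L → L ≢ I → f L ≡ 0ℤ) → ∑ (𝒫 n) f ≡ f I
∑-𝒫-single []ᵥ f h = ℤP.+-identityʳ _
∑-𝒫-single {suc n} (true ∷ᵥ I) f h = trans (∑-𝒫-suc n f) (trans
  (cong₂ _+_ (∑-𝒫-single I _ (λ L ne → h _ (ne ∘ VecP.∷-injectiveʳ))) (∑-zero (𝒫 n) (λ L → h _ λ ())))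
  (ℤP.+-identityʳ _))
∑-𝒫-single {suc n} (false ∷ᵥ I) f h = trans (∑-𝒫-suc n f) (trans
  (cong₂ _+_ (∑-zero (𝒫 n) (λ L → h _ λ ())) (∑-𝒫-single I _ (λ L ne → h _ (ne ∘ VecP.∷-injectiveʳ))))
  (ℤP.+-identityˡ _))

-- The sum of φ ∣K∣ over all K with A ⊆ K ⊆ A ∪ B, where A and B are disjoint of sizes a and d.
intervalSum : (ℕ → ℤ) → ℕ → ℕ → ℤ
intervalSum φ a zero    = φ a
intervalSum φ a (suc d) = intervalSum φ (suc a) d + intervalSum φ a d

intervalSum-shift : ∀ φ a d → intervalSum (φ ∘ suc) a d ≡ intervalSum φ (suc a) d
intervalSum-shift φ a zero    = refl
intervalSum-shift φ a (suc d) = cong₂ _+_ (intervalSum-shift φ (suc a) d) (intervalSum-shift φ a d)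

-- Only the sizes from `a` to `a + d` occur in the interval.
intervalSum-cong : ∀ {φ ψ} a d → (∀ u → u ℕ.≤ d → φ (a ℕ.+ u) ≡ ψ (a ℕ.+ u)) →
  intervalSum φ a d ≡ intervalSum ψ a d
intervalSum-cong {φ} {ψ} a zero h = subst (λ z → φ z ≡ ψ z) (ℕP.+-identityʳ a) (h 0 ℕ.z≤n)
intervalSum-cong {φ} {ψ} a (suc d) h = cong₂ _+_
  (intervalSum-cong (suc a) d (λ u u≤d → subst (λ z → φ z ≡ ψ z) (ℕP.+-suc a u) (h (suc u) (ℕ.s≤s u≤d))))
  (intervalSum-cong a d (λ u u≤d → h u (ℕP.m≤n⇒m≤1+n u≤d)))

intervalSum-zero : ∀ a d → intervalSum (λ _ → 0ℤ) a d ≡ 0ℤ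
intervalSum-zero a zero    = refl
intervalSum-zero a (suc d) = cong₂ _+_ (intervalSum-zero (suc a) d) (intervalSum-zero a d)

-- The bounds are predicates, so that the minimal elements outside an ideal or the maximal elements
-- inside one can serve as `B` directly.
Between : ∀ {n} (A B : Fin n → Set) → Vec Bool n → Set
Between A B K = ∀ x → (A x → x ∈ₛ K) × (x ∈ₛ K → A x ⊎ B x)

between? : ∀ {n} {A B : Fin n → Set} (A? : ∀ x → Dec (A x)) (B? : ∀ x → Dec (B x)) (K : Vec Bool n) →
  Dec (Between A B K)
between? A? B? K = FinP.all? λ x →
  (A? x →-dec (lookup K x Bool.≟ true)) ×-dec ((lookup K x Bool.≟ true) →-dec (A? x ⊎-dec B? x))

-- Induction on the ground set. The first element is forced into `K`, free, or forced out, according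
-- to whether it lies in `A`, in `B`, or in neither; a free element gives the two summands in the
-- recursion of `intervalSum`.
∑-between : ∀ {n} {A B : Fin n → Set} (A? : ∀ x → Dec (A x)) (B? : ∀ x → Dec (B x)) →
  (∀ x → A x → ¬ B x) → (φ : ℕ → ℤ) →
  ∑ (𝒫 n) (λ K → ⟦ between? A? B? K ⟧ * φ (size K)) ≡ intervalSum φ (countFin A?) (countFin B?)
∑-between {zero} A? B? disjoint φ =
  trans (ℤP.+-identityʳ _) (⟦⟧*-yes (between? A? B? []ᵥ) {φ 0} (λ ()))
∑-between {suc n} {A} {B} A? B? disjoint φ
  rewrite count-suc A? | count-suc B? = trans (∑-𝒫-suc n _) (step (A? zero) (B? zero))
  where
  tail? = between? (A? ∘ suc) (B? ∘ suc)
  cons : ∀ b {K} → (A zero → b ≡ true) → (b ≡ true → A zero ⊎ B zero) →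
    Between (A ∘ suc) (B ∘ suc) K → Between A B (b ∷ᵥ K)
  cons b f g h zero    = f , g
  cons b f g h (suc x) = h x
  keep : ∀ b (ψ : ℕ → ℤ) → (∀ K → φ (size (b ∷ᵥ K)) ≡ ψ (size K)) →
    (A zero → b ≡ true) → (b ≡ true → A zero ⊎ B zero) →
    ∑ (𝒫 n) (λ K → ⟦ between? A? B? (b ∷ᵥ K) ⟧ * φ (size (b ∷ᵥ K)))
      ≡ intervalSum ψ (countFin (A? ∘ suc)) (countFin (B? ∘ suc))
  keep b ψ eq f g = trans
    (∑-cong (𝒫 n) λ K → ⟦⟧*-cong (between? A? B? (b ∷ᵥ K)) (tail? K) (λ h → h ∘ suc) (cons b f g) (λ _ → eq K))
    (∑-between (A? ∘ suc) (B? ∘ suc) (disjoint ∘ suc) ψ)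
  drop : ∀ b → ¬ ((A zero → b ≡ true) × (b ≡ true → A zero ⊎ B zero)) →
    ∑ (𝒫 n) (λ K → ⟦ between? A? B? (b ∷ᵥ K) ⟧ * φ (size (b ∷ᵥ K))) ≡ 0ℤ
  drop b ¬h = ∑-zero (𝒫 n) λ K → ⟦⟧*-zero (between? A? B? (b ∷ᵥ K)) (λ h → contradiction (h zero) ¬h)
  with-true = keep true (φ ∘ suc) (λ K → cong φ (size-∷ true K)) (λ _ → refl)
  with-false = keep false φ (λ K → cong φ (size-∷ false K))
  #A = countFin (A? ∘ suc)
  #B = countFin (B? ∘ suc)
  step : (a? : Dec (A zero)) (b? : Dec (B zero)) →
    ∑ (𝒫 n) (λ K → ⟦ between? A? B? (true ∷ᵥ K) ⟧ * φ (size (true ∷ᵥ K)))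
      + ∑ (𝒫 n) (λ K → ⟦ between? A? B? (false ∷ᵥ K) ⟧ * φ (size (false ∷ᵥ K)))
      ≡ intervalSum φ (bit a? ℕ.+ countFin (A? ∘ suc)) (bit b? ℕ.+ countFin (B? ∘ suc))
  step (yes a) (yes b) = contradiction b (disjoint zero a)
  step (yes a) (no ¬b) = trans
    (cong₂ _+_ (with-true (λ _ → inj₁ a)) (drop false (λ h → contradiction (proj₁ h a) λ ())))
    (trans (ℤP.+-identityʳ _) (intervalSum-shift φ #A #B))
  step (no ¬a) (yes b) = cong₂ _+_
    (trans (with-true (λ _ → inj₂ b)) (intervalSum-shift φ #A #B))
    (with-false (λ a → contradiction a ¬a) (λ ()))
  step (no ¬a) (no ¬b) = trans
    (cong₂ _+_ (drop true (λ h → Sum.[ ¬a , ¬b ] (proj₂ h refl))) (with-false (λ a → contradiction a ¬a) (λ ())))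
    (ℤP.+-identityˡ _)

-- The sum counts the choices of `s` elements of `B` to add to `A`. The branch that adds the first
-- element of `B` has one element fewer to choose, which is Pascal's rule.
intervalSum-C : ∀ a d s → intervalSum (λ k → ⟦ k ℕ.≟ a ℕ.+ s ⟧) a d ≡ pos (d C s)
intervalSum-C a zero zero = ⟦⟧-yes (a ℕ.≟ a ℕ.+ 0) (sym (ℕP.+-identityʳ a))
intervalSum-C a zero (suc s) = trans
  (⟦⟧-no (a ℕ.≟ a ℕ.+ suc s) (ℕP.m≢1+m+n a ∘ λ e → trans e (ℕP.+-suc a s)))
  (cong pos (sym (k>n⇒nCk≡0 {0} {suc s} (ℕ.s≤s ℕ.z≤n))))
intervalSum-C a (suc d) zero = begin
  intervalSum φ (suc a) d + intervalSum φ a d   ≡⟨ cong₂ _+_ first (intervalSum-C a d 0) ⟩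
  0ℤ + pos (d C 0)                              ≡⟨ ℤP.+-identityˡ _ ⟩
  pos (d C 0)                                   ≡⟨ refl ⟩
  pos (suc d C 0)                               ∎
  where
  φ = λ k → ⟦ k ℕ.≟ a ℕ.+ 0 ⟧
  first : intervalSum φ (suc a) d ≡ 0ℤ
  first = trans (intervalSum-cong (suc a) d λ u _ → ⟦⟧-no (suc a ℕ.+ u ℕ.≟ a ℕ.+ 0)
                  (ℕP.m≢1+m+n a ∘ λ e → trans (sym (ℕP.+-identityʳ a)) (sym e)))
                (intervalSum-zero (suc a) d)
intervalSum-C a (suc d) (suc s) = begin
  intervalSum φ (suc a) d + intervalSum φ a d   ≡⟨ cong₂ _+_ first (intervalSum-C a d (suc s)) ⟩
  pos (d C s ℕ.+ d C suc s)                     ≡⟨ cong pos (nCk+nC[k+1]≡[n+1]C[k+1] d s) ⟩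
  pos (suc d C suc s)                           ∎
  where
  φ = λ k → ⟦ k ℕ.≟ a ℕ.+ suc s ⟧
  first : intervalSum φ (suc a) d ≡ pos (d C s)
  first = trans (intervalSum-cong (suc a) d λ u _ → cong (λ z → ⟦ suc a ℕ.+ u ℕ.≟ z ⟧) (ℕP.+-suc a s))
                (intervalSum-C (suc a) d s)

-- The complementary count: `s` is now the number of elements of `B` left out. The roles of the two
-- branches are exchanged, and leaving an element out contributes `previous s`.
intervalSum-C′ : ∀ a d s → intervalSum (λ k → ⟦ a ℕ.+ d ℕ.≟ k ℕ.+ s ⟧) a d ≡ pos (d C s)
intervalSum-C′ a zero zero = ⟦⟧-yes (a ℕ.+ 0 ℕ.≟ a ℕ.+ 0) refl
intervalSum-C′ a zero (suc s) = trans
  (⟦⟧-no (a ℕ.+ 0 ℕ.≟ a ℕ.+ suc s) (λ e → contradiction (ℕP.+-cancelˡ-≡ a 0 (suc s) e) λ ()))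
  (cong pos (sym (k>n⇒nCk≡0 {0} {suc s} (ℕ.s≤s ℕ.z≤n))))
intervalSum-C′ a (suc d) s = trans (cong₂ _+_ first (second s)) (pascal s)
  where
  first : intervalSum (λ k → ⟦ a ℕ.+ suc d ℕ.≟ k ℕ.+ s ⟧) (suc a) d ≡ pos (d C s)
  first = trans (intervalSum-cong (suc a) d λ u _ → cong (λ z → ⟦ z ℕ.≟ suc a ℕ.+ u ℕ.+ s ⟧) (ℕP.+-suc a d))
                (intervalSum-C′ (suc a) d s)
  previous : ℕ → ℤ
  previous zero    = 0ℤ
  previous (suc s) = pos (d C s)
  second : ∀ s → intervalSum (λ k → ⟦ a ℕ.+ suc d ℕ.≟ k ℕ.+ s ⟧) a d ≡ previous s
  second zero = trans
    (intervalSum-cong a d λ u u≤d → ⟦⟧-no (a ℕ.+ suc d ℕ.≟ a ℕ.+ u ℕ.+ 0)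
      (λ e → ℕP.<⇒≢ (ℕ.s≤s u≤d) (sym (ℕP.+-cancelˡ-≡ a (suc d) u (trans e (ℕP.+-identityʳ _))))))
    (intervalSum-zero a d)
  second (suc s) = trans
    (intervalSum-cong a d λ u _ → ⟦⟧-cong (a ℕ.+ suc d ℕ.≟ a ℕ.+ u ℕ.+ suc s) (a ℕ.+ d ℕ.≟ a ℕ.+ u ℕ.+ s)
      (λ e → ℕP.suc-injective (trans (sym (ℕP.+-suc a d)) (trans e (ℕP.+-suc (a ℕ.+ u) s))))
      (λ e → trans (ℕP.+-suc a d) (trans (cong suc e) (sym (ℕP.+-suc (a ℕ.+ u) s)))))
    (intervalSum-C′ a d s)
  pascal : ∀ s → pos (d C s) + previous s ≡ pos (suc d C s)
  pascal zero    = ℤP.+-identityʳ _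
  pascal (suc s) = cong pos (trans (ℕP.+-comm (d C suc s) (d C s)) (nCk+nC[k+1]≡[n+1]C[k+1] d s))

sgn : ℕ → ℤ
sgn zero    = 1ℤ
sgn (suc k) = - sgn k

sgn² : ∀ k → sgn k * sgn k ≡ 1ℤ
sgn² zero    = refl
sgn² (suc k) = trans (neg*neg (sgn k)) (sgn² k)
  where
  neg*neg : ∀ x → (- x) * (- x) ≡ x * x
  neg*neg = solve-∀

-- Adding or removing one fixed element of `B` reverses the sign, so the subsets cancel in pairs.
intervalSum-sgn : ∀ a d → d ≢ 0 → intervalSum sgn a d ≡ 0ℤ
intervalSum-sgn a zero    d≢0 = contradiction refl d≢0
intervalSum-sgn a (suc d) _   = trans (cong (_+ intervalSum sgn a d) (negate a d)) (ℤP.+-inverseˡ (intervalSum sgn a d))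
  where
  negate : ∀ a d → intervalSum sgn (suc a) d ≡ - intervalSum sgn a d
  negate a zero    = refl
  negate a (suc d) = trans (cong₂ _+_ (negate (suc a) d) (negate a d))
    (sym (ℤP.neg-distrib-+ (intervalSum sgn (suc a) d) (intervalSum sgn a d)))

-- Sums over chains of order ideals

atSize : ∀ {n} → ℕ → (Vec Bool n → ℤ) → Vec Bool n → ℤ
atSize k f I = ⟦ size I ℕ.≟ k ⟧ * f I

module _ {n : ℕ} (P : NLPoset n) where

  -- Equality on ideals suffices: started at an ideal, the operators below evaluate their argument
  -- at ideals only. The inversion `Anti-sgn-Up` is proved only there.
  _≐_ : (f g : Vec Bool n → ℤ) → Set
  f ≐ g = ∀ I → IsOrderIdeal P I → f I ≡ g I

  Above : Vec Bool n → Vec Bool n → Set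
  Above I L = IsOrderIdeal P L × I ⊆ L

  above? : ∀ I L → Dec (Above I L)
  above? I L = isOrderIdeal? P L ×-dec (I ⊆? L)

  -- This is the zeta operator of the lattice of order ideals; `UpBy s` is its part that raises the
  -- size by `s`.
  Up : (Vec Bool n → ℤ) → Vec Bool n → ℤ
  Up f I = ∑ (𝒫 n) λ L → ⟦ above? I L ⟧ * f L

  above-by? : ∀ s I L → Dec (Above I L × size L ≡ size I ℕ.+ s)
  above-by? s I L = above? I L ×-dec (size L ℕ.≟ size I ℕ.+ s)

  UpBy : ℕ → (Vec Bool n → ℤ) → Vec Bool n → ℤ
  UpBy s f I = ∑ (𝒫 n) λ L → ⟦ above-by? s I L ⟧ * f L

  -- The list holds the successive size differences, zero allowed, and `f` is evaluated at the last
  -- ideal of the chain.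
  chain : List ℕ → (Vec Bool n → ℤ) → Vec Bool n → ℤ
  chain []       f = f
  chain (s ∷ ss) f = UpBy s (chain ss f)

  -- For an ideal `I` these are exactly the ideals above `I` that differ from it by an antichain: an
  -- element of such an antichain has nothing below it outside `I` but itself.
  antichain? : ∀ I K → Dec (Between (_∈ₛ I) (IsMinOutside P I) K)
  antichain? I K = between? (λ x → lookup I x Bool.≟ true) (isMinOutside? P I) K

  Anti : (Vec Bool n → ℤ) → Vec Bool n → ℤ
  Anti f I = ∑ (𝒫 n) λ K → ⟦ antichain? I K ⟧ * f K

  ∅-ideal : IsOrderIdeal P ∅
  ∅-ideal x y x∈∅ = contradiction x∈∅ (x∉∅ x)

  antichain-ideal : ∀ I K → IsOrderIdeal P I → Between (_∈ₛ I) (IsMinOutside P I) K → IsOrderIdeal P K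
  antichain-ideal I K idI b x y x∈K y≼x with proj₂ (b x) x∈K
  ... | inj₁ x∈I = proj₁ (b y) (idI x y x∈I y≼x)
  ... | inj₂ (x∉I , minimal) = go (lookup I y) refl
    where
    go : ∀ c → lookup I y ≡ c → y ∈ₛ K
    go true  y∈I = proj₁ (b y) y∈I
    go false y∉I = subst (_∈ₛ K) (sym (minimal y y∉I y≼x)) x∈K

  chain-cong : ∀ ss {f g} → f ≐ g → chain ss f ≐ chain ss g
  chain-cong []       h I idI = h I idI
  chain-cong (s ∷ ss) h I idI = ∑-cong (𝒫 n) λ L → let d = above-by? s I L in
    ⟦⟧*-cong d d id id (λ ((idL , _) , _) → chain-cong ss h L idL)

  Anti-cong : ∀ {f g} → f ≐ g → Anti f ≐ Anti g
  Anti-cong h I idI = ∑-cong (𝒫 n) λ K → let d = antichain? I K in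
    ⟦⟧*-cong d d id id (λ b → h K (antichain-ideal I K idI b))

  chain-∑ : ∀ {A : Set} ss (xs : List A) (f : A → Vec Bool n → ℤ) I →
    chain ss (λ I → ∑ xs (λ x → f x I)) I ≡ ∑ xs (λ x → chain ss (f x) I)
  chain-∑ []       xs f I = refl
  chain-∑ (s ∷ ss) xs f I = trans
    (∑-cong (𝒫 n) (λ L → cong (⟦ above-by? s I L ⟧ *_) (chain-∑ ss xs f L)))
    (∑-linear xs (𝒫 n) (λ L → ⟦ above-by? s I L ⟧) (λ x → chain ss (f x)))

  chain-+ : ∀ ss (f g : Vec Bool n → ℤ) I → chain ss (λ I → f I + g I) I ≡ chain ss f I + chain ss g I
  chain-+ []       f g I = refl
  chain-+ (s ∷ ss) f g I = trans
    (∑-cong (𝒫 n) (λ L → trans (cong (⟦ above-by? s I L ⟧ *_) (chain-+ ss f g L)) (ℤP.*-distribˡ-+ ⟦ above-by? s I L ⟧ _ _)))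
    (∑-+ (𝒫 n) _ _)

  Anti-∑ : ∀ {A : Set} (xs : List A) (f : A → Vec Bool n → ℤ) I →
    Anti (λ I → ∑ xs (λ x → f x I)) I ≡ ∑ xs (λ x → Anti (f x) I)
  Anti-∑ xs f I = ∑-linear xs (𝒫 n) (λ K → ⟦ antichain? I K ⟧) f

  Anti-+ : ∀ (f g : Vec Bool n → ℤ) I → Anti (λ I → f I + g I) I ≡ Anti f I + Anti g I
  Anti-+ f g I = trans
    (∑-cong (𝒫 n) (λ K → ℤP.*-distribˡ-+ ⟦ antichain? I K ⟧ (f K) (g K)))
    (∑-+ (𝒫 n) _ _)

  -- A step appended at the top of the chain acts on `f`. This makes agreement over all chains
  -- stable under `UpBy`.
  chain-++ : ∀ ss t (f : Vec Bool n → ℤ) I → chain (ss ++ [ t ]) f I ≡ chain ss (UpBy t f) I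
  chain-++ []       t f I = refl
  chain-++ (s ∷ ss) t f I = ∑-cong (𝒫 n) (λ L → cong (⟦ above-by? s I L ⟧ *_) (chain-++ ss t f L))

  -- The step sizes determine the size of the last ideal, so a weight that depends on size alone is
  -- constant along the sum.
  chain-weight : ∀ ss (φ : ℕ → ℤ) (f : Vec Bool n → ℤ) I →
    chain ss (λ I → φ (size I) * f I) I ≡ φ (size I ℕ.+ sum ss) * chain ss f I
  chain-weight []       φ f I = cong (λ k → φ k * f I) (sym (ℕP.+-identityʳ (size I)))
  chain-weight (s ∷ ss) φ f I = trans
    (∑-cong (𝒫 n) λ L → let d = above-by? s I L in trans
      (⟦⟧*-cong d d id id (λ (_ , eq) → trans (chain-weight ss φ f L)
        (cong (λ k → φ k * chain ss f L) (trans (cong (ℕ._+ sum ss) eq) (ℕP.+-assoc (size I) s (sum ss))))))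
      (*-exchange ⟦ d ⟧ (φ (size I ℕ.+ (s ℕ.+ sum ss))) (chain ss f L)))
    (∑-*ˡ (𝒫 n) (φ (size I ℕ.+ (s ℕ.+ sum ss))) (λ L → ⟦ above-by? s I L ⟧ * chain ss f L))

  size≤n : ∀ (I : Vec Bool n) → size I ℕ.≤ n
  size≤n I = count≤n (λ x → lookup I x Bool.≟ true)

  -- The ideals above `I` are sorted by their size difference from `I`. The bound `N` is left free
  -- so that two posets can share one range of summation.
  Up-graded : ∀ {N} → n ℕ.≤ N → ∀ f I → Up f I ≡ ∑ (upTo (suc N)) (λ s → UpBy s f I)
  Up-graded {N} n≤N f I = trans
    (∑-cong (𝒫 n) λ L → trans (cong (_* f L) (level L)) (sym (∑-*ʳ (upTo (suc N)) (λ s → ⟦ above-by? s I L ⟧) (f L))))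
    (∑-swap (𝒫 n) (upTo (suc N)) (λ L s → ⟦ above-by? s I L ⟧ * f L))
    where
    level : ∀ L → ⟦ above? I L ⟧ ≡ ∑ (upTo (suc N)) (λ s → ⟦ above-by? s I L ⟧)
    level L = let d = above? I L in sym (trans
      (∑-cong (upTo (suc N)) λ s → ⟦⟧-× d (size L ℕ.≟ size I ℕ.+ s))
      (trans (∑-*ˡ (upTo (suc N)) ⟦ d ⟧ _)
      (trans (⟦⟧*-cong d d id id (λ (_ , I⊆L) → one (size-mono I L I⊆L))) (ℤP.*-identityʳ _))))
      where
      one : size I ℕ.≤ size L → ∑ (upTo (suc N)) (λ s → ⟦ size L ℕ.≟ size I ℕ.+ s ⟧) ≡ 1ℤ
      one I≤L = trans
        (∑-cong (upTo (suc N)) λ s → trans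
          (⟦⟧-cong (size L ℕ.≟ size I ℕ.+ s) (size L ℕ.∸ size I ℕ.≟ s)
            (λ e → trans (cong (ℕ._∸ size I) e) (ℕP.m+n∸m≡n (size I) s))
            (λ e → trans (sym (ℕP.m+[n∸m]≡n I≤L)) (cong (size I ℕ.+_) e)))
          (sym (ℤP.*-identityʳ _)))
        (∑-upTo-select (size L ℕ.∸ size I) (λ _ → 1ℤ)
          (ℕ.s≤s (ℕP.≤-trans (ℕP.m∸n≤m (size L) (size I)) (ℕP.≤-trans (size≤n L) n≤N))))

  minOut : Vec Bool n → ℕ
  minOut I = countFin (isMinOutside? P I)

  maxIn : Vec Bool n → ℕ
  maxIn I = countFin (isMaxIn? P I)

  -- Möbius inversion in the lattice of order ideals

  minimal-within? : ∀ I L x → Dec (IsMinOutside P I x × x ∈ₛ L)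
  minimal-within? I L x = isMinOutside? P I x ×-dec (lookup L x Bool.≟ true)

  -- A least label in L ∖ I is minimal outside I because P is naturally labeled.
  no-minimal⇒⊆ : ∀ I L → IsOrderIdeal P L → (∀ x → ¬ (IsMinOutside P I x × x ∈ₛ L)) → L ⊆ I
  no-minimal⇒⊆ I L idL none x x∈L = go x (FinI.<-wellFounded x) x∈L
    where
    go : ∀ x → Acc Fin._<_ x → x ∈ₛ L → x ∈ₛ I
    go x (acc rec) x∈L with lookup I x in x∉I
    ... | true  = refl
    ... | false = contradiction ((x∉I , minimal) , x∈L) (none x)
      where
      minimal : ∀ y → y ∉ₛ I → _≼_ P y x → y ≡ x
      minimal y y∉I y≼x with y FinP.≟ x
      ... | yes y≡x = y≡x
      ... | no  y≢x = contradiction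
        (go y (rec (FinP.≤∧≢⇒< (natural P y≼x) y≢x)) (idL x y x∈L y≼x)) (∉ₛ⇒∉ I y∉I)

  -- The coefficient of `f L` when `Anti` is applied to the signed `Up f` and evaluated at `I`.
  antichains-below : Vec Bool n → Vec Bool n → ℤ
  antichains-below I L = ∑ (𝒫 n) λ K → (⟦ antichain? I K ⟧ * ⟦ above? K L ⟧) * sgn (size K)

  -- The sets `K` form a Boolean interval: they arise from `I` by adding any of the minimal elements
  -- outside `I` that lie in `L`.
  antichains-below-above : ∀ I L → Above I L →
    antichains-below I L ≡ intervalSum sgn (size I) (countFin (minimal-within? I L))
  antichains-below-above I L (idL , I⊆L) = trans
    (∑-cong (𝒫 n) λ K → trans
      (cong (_* sgn (size K)) (sym (⟦⟧-× (antichain? I K) (above? K L))))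
      (⟦⟧*-cong (antichain? I K ×-dec above? K L)
        (between? (λ x → lookup I x Bool.≟ true) (minimal-within? I L) K)
        (to K) (from K) (λ _ → refl)))
    (∑-between (λ x → lookup I x Bool.≟ true) (minimal-within? I L)
      (λ x x∈I ((x∉I , _) , _) → ∉ₛ⇒∉ I x∉I x∈I) sgn)
    where
    to : ∀ K → Between (_∈ₛ I) (IsMinOutside P I) K × Above K L →
      Between (_∈ₛ I) (λ x → IsMinOutside P I x × x ∈ₛ L) K
    to K (b , _ , K⊆L) x = proj₁ (b x) , λ x∈K → Sum.map₂ (_, K⊆L x x∈K) (proj₂ (b x) x∈K)
    from : ∀ K → Between (_∈ₛ I) (λ x → IsMinOutside P I x × x ∈ₛ L) K →
      Between (_∈ₛ I) (IsMinOutside P I) K × Above K L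
    from K b = (λ x → proj₁ (b x) , Sum.map₂ proj₁ ∘ proj₂ (b x)) ,
      idL , λ x x∈K → Sum.[ I⊆L x , proj₂ ] (proj₂ (b x) x∈K)

  -- If `L` is an ideal properly containing `I`, some minimal element outside `I` lies in `L`, and
  -- the signed sum over a nontrivial interval vanishes. Otherwise no `K` fits between `I` and `L`.
  antichains-below-≢ : ∀ I L → L ≢ I → antichains-below I L ≡ 0ℤ
  antichains-below-≢ I L L≢I = go (above? I L)
    where
    go : Dec (Above I L) → antichains-below I L ≡ 0ℤ
    go (yes (idL , I⊆L)) = trans (antichains-below-above I L (idL , I⊆L))
      (intervalSum-sgn (size I) _ λ none → L≢I (⊆-antisym L I
        (no-minimal⇒⊆ I L idL (count-zero⁻ (minimal-within? I L) none)) I⊆L))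
    go (no ¬above) = ∑-zero (𝒫 n) λ K → trans
      (cong (_* sgn (size K)) (sym (⟦⟧-× (antichain? I K) (above? K L))))
      (⟦⟧*-zero (antichain? I K ×-dec above? K L) λ (b , idL , K⊆L) →
        contradiction (idL , λ x x∈I → K⊆L x (proj₁ (b x) x∈I)) ¬above)

  antichains-below-self : ∀ I → IsOrderIdeal P I → antichains-below I I ≡ sgn (size I)
  antichains-below-self I idI = trans (antichains-below-above I I (idI , λ _ x∈I → x∈I))
    (cong (intervalSum sgn (size I)) (count-zero (minimal-within? I I) λ x ((x∉I , _) , x∈I) → ∉ₛ⇒∉ I x∉I x∈I))

  -- The Möbius function of the lattice of ideals is a sign on pairs that differ by an antichain and
  -- zero elsewhere, so `Anti` conjugated by signs inverts `Up`.
  Anti-sgn-Up : ∀ f → Anti (λ K → sgn (size K) * Up f K) ≐ (λ I → sgn (size I) * f I)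
  Anti-sgn-Up f I idI = begin
    ∑ (𝒫 n) (λ K → ⟦ antichain? I K ⟧ * (sgn (size K) * ∑ (𝒫 n) (λ L → ⟦ above? K L ⟧ * f L)))
      ≡⟨ ∑-cong (𝒫 n) (λ K → expand K) ⟩
    ∑ (𝒫 n) (λ K → ∑ (𝒫 n) (λ L → term K L * f L))
      ≡⟨ ∑-swap (𝒫 n) (𝒫 n) (λ K L → term K L * f L) ⟩
    ∑ (𝒫 n) (λ L → ∑ (𝒫 n) (λ K → term K L * f L))
      ≡⟨ ∑-cong (𝒫 n) (λ L → ∑-*ʳ (𝒫 n) (λ K → term K L) (f L)) ⟩
    ∑ (𝒫 n) (λ L → antichains-below I L * f L)
      ≡⟨ ∑-𝒫-single I (λ L → antichains-below I L * f L) (λ L L≢I → cong (_* f L) (antichains-below-≢ I L L≢I)) ⟩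
    antichains-below I I * f I
      ≡⟨ cong (_* f I) (antichains-below-self I idI) ⟩
    sgn (size I) * f I ∎
    where
    term : Vec Bool n → Vec Bool n → ℤ
    term K L = (⟦ antichain? I K ⟧ * ⟦ above? K L ⟧) * sgn (size K)
    regroup : ∀ a s b y → a * (s * (b * y)) ≡ ((a * b) * s) * y
    regroup = solve-∀
    expand : ∀ K → ⟦ antichain? I K ⟧ * (sgn (size K) * ∑ (𝒫 n) (λ L → ⟦ above? K L ⟧ * f L))
                 ≡ ∑ (𝒫 n) (λ L → term K L * f L)
    expand K = trans
      (cong (⟦ antichain? I K ⟧ *_) (sym (∑-*ˡ (𝒫 n) (sgn (size K)) (λ L → ⟦ above? K L ⟧ * f L))))
      (trans (sym (∑-*ˡ (𝒫 n) ⟦ antichain? I K ⟧ (λ L → sgn (size K) * (⟦ above? K L ⟧ * f L))))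
        (∑-cong (𝒫 n) λ L → regroup ⟦ antichain? I K ⟧ (sgn (size K)) ⟦ above? K L ⟧ (f L)))

  -- Triangular inversion level by level

  Up-atSize-self : ∀ f I → IsOrderIdeal P I → Up (atSize (size I) f) I ≡ f I
  Up-atSize-self f I idI = trans
    (∑-𝒫-single I _ λ L L≢I → ⟦⟧*-zero (above? I L) λ (_ , I⊆L) →
      ⟦⟧*-zero (size L ℕ.≟ size I) λ eq → contradiction (sym (size-≡⇒≡ I L I⊆L (sym eq))) L≢I)
    (trans (⟦⟧*-yes (above? I I) (idI , λ _ x∈I → x∈I)) (⟦⟧*-yes (size I ℕ.≟ size I) refl))

  Up-atSize-zero : ∀ {k} f I → k ℕ.< size I → Up (atSize k f) I ≡ 0ℤ
  Up-atSize-zero {k} f I k<I = ∑-zero (𝒫 n) λ L → ⟦⟧*-zero (above? I L) λ (_ , I⊆L) →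
    ⟦⟧*-zero (size L ℕ.≟ k) λ eq → contradiction (size-mono I L I⊆L) (ℕP.<⇒≱ (subst (ℕ._< size I) (sym eq) k<I))

  -- The signs are placed so that `Anti (signedUp k f)` equals `atSize k f` on ideals, while the
  -- construction uses only `Up` and weights depending on size.
  signedUp : ℕ → (Vec Bool n → ℤ) → Vec Bool n → ℤ
  signedUp k f I = sgn (size I) * Up (atSize k (λ L → sgn (size L) * f L)) I

  cancel-sgn : ∀ k y → sgn k * (sgn k * y) ≡ y
  cancel-sgn k y = trans (sym (ℤP.*-assoc (sgn k) (sgn k) y)) (trans (cong (_* y) (sgn² k)) (ℤP.*-identityˡ y))

  -- No ideal of size `k` contains a larger one, and the only one containing an ideal of size `k` is
  -- that ideal itself. Hence `signedUp k f` vanishes above level `k` and equals `f` on it.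
  signedUp-levels : ∀ k f → signedUp k f ≐ (λ I → atSize k f I + ∑ (upTo k) (λ j → atSize j (signedUp k f) I))
  signedUp-levels k f I idI with ℕP.<-cmp (size I) k
  ... | tri< I<k _ _ = sym (trans
    (cong₂ _+_ (⟦⟧*-zero (size I ℕ.≟ k) (λ e → contradiction e (ℕP.<⇒≢ I<k)))
               (∑-upTo-select (size I) (λ _ → signedUp k f I) I<k))
    (ℤP.+-identityˡ _))
  ... | tri≈ _ refl _ = trans
    (trans (cong (sgn (size I) *_) (Up-atSize-self (λ L → sgn (size L) * f L) I idI)) (cancel-sgn (size I) (f I)))
    (sym (trans
      (cong₂ _+_ (⟦⟧*-yes (size I ℕ.≟ size I) refl)
        (trans (∑-cong-∈ (upTo (size I)) (λ j j∈ → ⟦⟧*-zero (size I ℕ.≟ j) {signedUp (size I) f I}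
                 λ e → contradiction (sym e) (ℕP.<⇒≢ (∈-upTo⁻ j∈))))
               (∑-zero (upTo (size I)) {λ _ → 0ℤ} (λ _ → refl))))
      (ℤP.+-identityʳ (f I))))
  ... | tri> _ I≢k k<I = trans zeroUp (sym (cong₂ _+_
      (⟦⟧*-zero (size I ℕ.≟ k) (λ e → contradiction e I≢k))
      (∑-zero (upTo k) (λ j → trans (cong (⟦ size I ℕ.≟ j ⟧ *_) zeroUp) (ℤP.*-zeroʳ ⟦ size I ℕ.≟ j ⟧)))))
    where
    zeroUp : signedUp k f I ≡ 0ℤ
    zeroUp = trans (cong (sgn (size I) *_) (Up-atSize-zero (λ L → sgn (size L) * f L) I k<I)) (ℤP.*-zeroʳ (sgn (size I)))

  -- Applying `Anti` to the levels of `signedUp k f` isolates `Anti (atSize k f)`; every other term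
  -- on the right lives on a level below `k`.
  Anti-level : ∀ k f → atSize k f ≐ (λ I → Anti (atSize k f) I + ∑ (upTo k) (λ j → Anti (atSize j (signedUp k f)) I))
  Anti-level k f I idI = begin
    atSize k f I
      ≡⟨ cong (⟦ size I ℕ.≟ k ⟧ *_) (cancel-sgn (size I) (f I)) ⟨
    ⟦ size I ℕ.≟ k ⟧ * (sgn (size I) * (sgn (size I) * f I))
      ≡⟨ *-exchange ⟦ size I ℕ.≟ k ⟧ (sgn (size I)) (sgn (size I) * f I) ⟩
    sgn (size I) * atSize k (λ L → sgn (size L) * f L) I
      ≡⟨ Anti-sgn-Up (atSize k (λ L → sgn (size L) * f L)) I idI ⟨
    Anti (signedUp k f) I
      ≡⟨ Anti-cong (signedUp-levels k f) I idI ⟩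
    Anti (λ I → atSize k f I + ∑ (upTo k) (λ j → atSize j (signedUp k f) I)) I
      ≡⟨ Anti-+ (atSize k f) (λ I → ∑ (upTo k) (λ j → atSize j (signedUp k f) I)) I ⟩
    Anti (atSize k f) I + Anti (λ I → ∑ (upTo k) (λ j → atSize j (signedUp k f) I)) I
      ≡⟨ cong (Anti (atSize k f) I +_) (Anti-∑ (upTo k) (λ j → atSize j (signedUp k f)) I) ⟩
    Anti (atSize k f) I + ∑ (upTo k) (λ j → Anti (atSize j (signedUp k f)) I) ∎

  -- Adding minimal elements and removing maximal ones

  ∑-antichains : ∀ I t → Anti (atSize (size I ℕ.+ t) (λ _ → 1ℤ)) I ≡ pos (minOut I C t)
  ∑-antichains I t = trans
    (∑-cong (𝒫 n) λ K → cong (⟦ antichain? I K ⟧ *_) (ℤP.*-identityʳ ⟦ size K ℕ.≟ size I ℕ.+ t ⟧))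
    (trans (∑-between (λ x → lookup I x Bool.≟ true) (isMinOutside? P I)
             (λ x x∈I (x∉I , _) → ∉ₛ⇒∉ I x∉I x∈I) (λ k → ⟦ k ℕ.≟ size I ℕ.+ t ⟧))
           (intervalSum-C (size I) (minOut I) t))

  nonmaximal? : ∀ I x → Dec (x ∈ₛ I × ¬ IsMaxIn P I x)
  nonmaximal? I x = (lookup I x Bool.≟ true) ×-dec ¬? (isMaxIn? P I x)

  size-maxIn : ∀ I → size I ≡ countFin (nonmaximal? I) ℕ.+ maxIn I
  size-maxIn I = count-⊎ (nonmaximal? I) (isMaxIn? P I) (λ x → lookup I x Bool.≟ true)
    split (λ _ → proj₁) (λ _ → proj₁) (λ _ → proj₂)
    where
    split : ∀ x → x ∈ₛ I → (x ∈ₛ I × ¬ IsMaxIn P I x) ⊎ IsMaxIn P I x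
    split x x∈I with isMaxIn? P I x
    ... | yes max = inj₂ max
    ... | no ¬max = inj₁ (x∈I , ¬max)

  -- If `x` was added to `J`, then any `y` in `I` above `x` lies outside the ideal `J`, so it was
  -- added as a minimal element too, and `y ≡ x`. Thus only maximal elements of `I` are missing from
  -- `J`.
  removals→ : ∀ I J → Above ∅ J × Between (_∈ₛ J) (IsMinOutside P J) I →
    Between (λ x → x ∈ₛ I × ¬ IsMaxIn P I x) (IsMaxIn P I) J
  removals→ I J ((idJ , _) , b) x = keep , split
    where
    keep : x ∈ₛ I × ¬ IsMaxIn P I x → x ∈ₛ J
    keep (x∈I , ¬max) with lookup J x in x∉J
    ... | true  = refl
    ... | false = contradiction (x∈I , maximal) ¬max
      where
      maximal : ∀ y → y ∈ₛ I → _≼_ P x y → y ≡ x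
      maximal y y∈I x≼y with proj₂ (b y) y∈I
      ... | inj₁ y∈J       = contradiction (idJ y x y∈J x≼y) (∉ₛ⇒∉ J x∉J)
      ... | inj₂ (_ , min) = sym (min x x∉J x≼y)
    split : x ∈ₛ J → (x ∈ₛ I × ¬ IsMaxIn P I x) ⊎ IsMaxIn P I x
    split x∈J with isMaxIn? P I x
    ... | yes max = inj₂ max
    ... | no ¬max = inj₁ (proj₁ (b x) x∈J , ¬max)

  -- A maximal element of `I` has nothing else of `I` above it, so its removal leaves an ideal. An
  -- element outside `J` and below a member of `I` was itself removed, hence is maximal in `I` and
  -- equal to that member.
  removals← : ∀ I J → IsOrderIdeal P I → Between (λ x → x ∈ₛ I × ¬ IsMaxIn P I x) (IsMaxIn P I) J →
    Above ∅ J × Between (_∈ₛ J) (IsMinOutside P J) I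
  removals← I J idI b = (idJ , λ x x∈∅ → contradiction x∈∅ (x∉∅ x)) , λ x → J⊆I x , outside x
    where
    J⊆I : J ⊆ I
    J⊆I x x∈J = Sum.[ proj₁ , proj₁ ] (proj₂ (b x) x∈J)
    idJ : IsOrderIdeal P J
    idJ x y x∈J y≼x with isMaxIn? P I y
    ... | yes (_ , max) = subst (_∈ₛ J) (max x (J⊆I x x∈J) y≼x) x∈J
    ... | no ¬max       = proj₁ (b y) (idI x y (J⊆I x x∈J) y≼x , ¬max)
    outside : ∀ x → x ∈ₛ I → x ∈ₛ J ⊎ IsMinOutside P J x
    outside x x∈I with lookup J x in x∉J
    ... | true  = inj₁ refl
    ... | false = inj₂ (refl , minimal)
      where
      minimal : ∀ y → y ∉ₛ J → _≼_ P y x → y ≡ x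
      minimal y y∉J y≼x with isMaxIn? P I y
      ... | yes (_ , max) = sym (max x x∈I y≼x)
      ... | no ¬max       = contradiction (proj₁ (b y) (idI x y x∈I y≼x , ¬max)) (∉ₛ⇒∉ J y∉J)

  ∑-removals : ∀ I s → IsOrderIdeal P I →
    ∑ (𝒫 n) (λ J → (⟦ above? ∅ J ⟧ * ⟦ antichain? J I ⟧) * ⟦ size I ℕ.≟ size J ℕ.+ s ⟧) ≡ pos (maxIn I C s)
  ∑-removals I s idI = trans
    (∑-cong (𝒫 n) λ J → trans
      (cong (_* ⟦ size I ℕ.≟ size J ℕ.+ s ⟧) (sym (⟦⟧-× (above? ∅ J) (antichain? J I))))
      (⟦⟧*-cong (above? ∅ J ×-dec antichain? J I) (between? (nonmaximal? I) (isMaxIn? P I) J)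
        (removals→ I J) (removals← I J idI)
        (λ _ → cong (λ z → ⟦ z ℕ.≟ size J ℕ.+ s ⟧) (size-maxIn I))))
    (trans (∑-between (nonmaximal? I) (isMaxIn? P I) (λ _ → proj₂)
             (λ k → ⟦ countFin (nonmaximal? I) ℕ.+ maxIn I ℕ.≟ k ℕ.+ s ⟧))
           (intervalSum-C′ (countFin (nonmaximal? I)) (maxIn I) s))

  AntiBy : ℕ → (Vec Bool n → ℤ) → Vec Bool n → ℤ
  AntiBy s f I = Anti (atSize (size I ℕ.+ s) f) I

  -- Double counting of pairs of ideals `J ⊆ I` with `I` of size `k` and `s` elements added to `J`
  -- by an antichain step. Summing over `I` first gives the right side; for fixed `I`, the `J` are
  -- the ways to remove `s` maximal elements.
  UpBy-maxIn : ∀ k s f → UpBy k (λ I → pos (maxIn I C s) * f I) ∅ ≡ Up (AntiBy s (atSize k f)) ∅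
  UpBy-maxIn k s f = sym (begin
    ∑ (𝒫 n) (λ J → ⟦ above? ∅ J ⟧ * ∑ (𝒫 n) (λ I → ⟦ antichain? J I ⟧ * (⟦ size I ℕ.≟ size J ℕ.+ s ⟧ * atSize k f I)))
      ≡⟨ ∑-linear (𝒫 n) (𝒫 n) (λ J → ⟦ above? ∅ J ⟧) (λ I J → ⟦ antichain? J I ⟧ * (⟦ size I ℕ.≟ size J ℕ.+ s ⟧ * atSize k f I)) ⟩
    ∑ (𝒫 n) (λ I → ∑ (𝒫 n) (λ J → ⟦ above? ∅ J ⟧ * (⟦ antichain? J I ⟧ * (⟦ size I ℕ.≟ size J ℕ.+ s ⟧ * atSize k f I))))
      ≡⟨ ∑-cong (𝒫 n) (λ I → trans
           (∑-cong (𝒫 n) λ J → regroup ⟦ above? ∅ J ⟧ ⟦ antichain? J I ⟧ ⟦ size I ℕ.≟ size J ℕ.+ s ⟧ (atSize k f I))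
           (∑-*ʳ (𝒫 n) (λ J → term I J) (atSize k f I))) ⟩
    ∑ (𝒫 n) (λ I → ∑ (𝒫 n) (term I) * atSize k f I)
      ≡⟨ ∑-cong (𝒫 n) (λ I → evaluate I (isOrderIdeal? P I)) ⟩
    ∑ (𝒫 n) (λ I → ⟦ above-by? k ∅ I ⟧ * (pos (maxIn I C s) * f I)) ∎)
    where
    term : Vec Bool n → Vec Bool n → ℤ
    term I J = (⟦ above? ∅ J ⟧ * ⟦ antichain? J I ⟧) * ⟦ size I ℕ.≟ size J ℕ.+ s ⟧
    regroup : ∀ a b c y → a * (b * (c * y)) ≡ ((a * b) * c) * y
    regroup = solve-∀
    size≡ : ∀ I → size I ≡ k → size I ≡ size (∅ {n}) ℕ.+ k
    size≡ I = subst (λ z → size I ≡ z ℕ.+ k) (sym (size-∅ {n}))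
    size≡⁻ : ∀ I → size I ≡ size (∅ {n}) ℕ.+ k → size I ≡ k
    size≡⁻ I = subst (λ z → size I ≡ z ℕ.+ k) (size-∅ {n})
    evaluate : ∀ I → Dec (IsOrderIdeal P I) →
      ∑ (𝒫 n) (term I) * atSize k f I ≡ ⟦ above-by? k ∅ I ⟧ * (pos (maxIn I C s) * f I)
    evaluate I (yes idI) = begin
      ∑ (𝒫 n) (term I) * atSize k f I
        ≡⟨ cong (_* atSize k f I) (∑-removals I s idI) ⟩
      pos (maxIn I C s) * (⟦ size I ℕ.≟ k ⟧ * f I)
        ≡⟨ *-exchange (pos (maxIn I C s)) ⟦ size I ℕ.≟ k ⟧ (f I) ⟩
      ⟦ size I ℕ.≟ k ⟧ * (pos (maxIn I C s) * f I)
        ≡⟨ ⟦⟧*-cong (size I ℕ.≟ k) (above-by? k ∅ I)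
             (λ e → (idI , λ x x∈∅ → contradiction x∈∅ (x∉∅ x)) , size≡ I e) (λ (_ , e) → size≡⁻ I e) (λ _ → refl) ⟩
      ⟦ above-by? k ∅ I ⟧ * (pos (maxIn I C s) * f I) ∎
    -- An antichain step from an ideal `J` ends in an ideal, so no `J` contributes here.
    evaluate I (no ¬idI) = trans
      (cong (_* atSize k f I) (∑-zero (𝒫 n) λ J → trans
        (cong (_* ⟦ size I ℕ.≟ size J ℕ.+ s ⟧) (sym (⟦⟧-× (above? ∅ J) (antichain? J I))))
        (⟦⟧*-zero (above? ∅ J ×-dec antichain? J I) λ ((idJ , _) , b) → contradiction (antichain-ideal J I idJ b) ¬idI)))
      (sym (⟦⟧*-zero (above-by? k ∅ I) λ ((idI , _) , _) → contradiction idI ¬idI))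

-- The binomial is expanded over the possible values of `x`: values below `i` give zero, `i` itself
-- gives one, and `suc i + e` runs through the larger values. The bound on `x` keeps the offset `e`
-- below `N`.
C-inversion : ∀ {N} x i → x ℕ.≤ N →
  pos (x C i) ≡ ⟦ x ℕ.≟ i ⟧ + ∑ (upTo N) (λ e → pos ((suc i ℕ.+ e) C i) * ⟦ x ℕ.≟ suc i ℕ.+ e ⟧)
C-inversion {N} x i x≤N with ℕP.<-cmp x i
... | tri< x<i x≢i _ = trans (cong pos (k>n⇒nCk≡0 x<i)) (sym (cong₂ _+_
  (⟦⟧-no (x ℕ.≟ i) x≢i)
  (∑-zero (upTo N) λ e → trans
    (cong (pos ((suc i ℕ.+ e) C i) *_) (⟦⟧-no (x ℕ.≟ suc i ℕ.+ e)
      (ℕP.<⇒≢ (ℕP.<-≤-trans x<i (ℕP.≤-trans (ℕP.n≤1+n i) (ℕP.m≤m+n (suc i) e))))))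
    (ℤP.*-zeroʳ (pos ((suc i ℕ.+ e) C i))))))
... | tri≈ _ refl _ = trans (cong pos (nCn≡1 x)) (sym (cong₂ _+_
  (⟦⟧-yes (x ℕ.≟ x) refl)
  (∑-zero (upTo N) λ e → trans
    (cong (pos ((suc x ℕ.+ e) C x) *_) (⟦⟧-no (x ℕ.≟ suc x ℕ.+ e) (ℕP.m≢1+m+n x)))
    (ℤP.*-zeroʳ (pos ((suc x ℕ.+ e) C x))))))
... | tri> _ x≢i i<x = sym (trans
  (cong₂ _+_ (⟦⟧-no (x ℕ.≟ i) x≢i)
    (trans (∑-cong (upTo N) λ e → trans (ℤP.*-comm (pos ((suc i ℕ.+ e) C i)) ⟦ x ℕ.≟ suc i ℕ.+ e ⟧)
              (cong (_* pos ((suc i ℕ.+ e) C i)) (⟦⟧-cong (x ℕ.≟ suc i ℕ.+ e) (x ℕ.∸ suc i ℕ.≟ e)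
                (λ eq → trans (cong (ℕ._∸ suc i) eq) (ℕP.m+n∸m≡n (suc i) e))
                (λ eq → trans (sym (ℕP.m+[n∸m]≡n i<x)) (cong (suc i ℕ.+_) eq)))))
      (∑-upTo-select (x ℕ.∸ suc i) (λ e → pos ((suc i ℕ.+ e) C i))
        (ℕP.<-≤-trans (ℕP.m<n+o⇒m∸n<o x (suc i) {x} {{ℕ.>-nonZero (ℕP.≤-<-trans ℕ.z≤n i<x)}} (ℕP.m<n+m x (ℕ.s≤s ℕ.z≤n))) x≤N))))
  (trans (ℤP.+-identityˡ _) (cong (λ z → pos (z C i)) (ℕP.m+[n∸m]≡n i<x))))

-- Agreement of chain sums for two posets

module _ {n m : ℕ} (P : NLPoset n) (Q : NLPoset m) where

  -- N bounds the cardinalities of both posets, so n ≡ m need not be known.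
  N : ℕ
  N = n ℕ.+ m

  record Agree (ss : List ℕ) (f : Vec Bool n → ℤ) (g : Vec Bool m → ℤ) : Set where
    constructor agree
    field agreement : chain P ss f ∅ ≡ chain Q ss g ∅

  open Agree

  -- Agreement for every list of step sizes, not just one, leaves room to absorb further steps and
  -- so gives closure under the summation operators.
  Matched : (Vec Bool n → ℤ) → (Vec Bool m → ℤ) → Set
  Matched f g = ∀ ss → Agree ss f g

  agree-resp : ∀ {ss f f′ g g′} → _≐_ P f f′ → _≐_ Q g g′ → Agree ss f g → Agree ss f′ g′
  agree-resp {ss} f≐f′ g≐g′ (agree h) = agree (trans
    (sym (chain-cong P ss f≐f′ ∅ (∅-ideal P))) (trans h (chain-cong Q ss g≐g′ ∅ (∅-ideal Q))))

  agree-∑ : ∀ {ss} {A : Set} (xs : List A) (f : A → Vec Bool n → ℤ) (g : A → Vec Bool m → ℤ) →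
    (∀ x → x ∈ xs → Agree ss (f x) (g x)) → Agree ss (λ I → ∑ xs (λ x → f x I)) (λ I → ∑ xs (λ x → g x I))
  agree-∑ {ss} xs f g h = agree (trans (chain-∑ P ss xs f ∅)
    (trans (∑-cong-∈ xs (λ x x∈xs → agreement (h x x∈xs))) (sym (chain-∑ Q ss xs g ∅))))

  -- The subtraction step of both triangular inversions, that of `Anti` by levels and that of the
  -- binomials.
  agree-cancel : ∀ {ss f f′ g g′} → Agree ss (λ I → f I + f′ I) (λ I → g I + g′ I) → Agree ss f′ g′ → Agree ss f g
  agree-cancel {ss} {f} {f′} {g} {g′} (agree h) (agree h′) = agree (∙-cancelʳ (chain P ss f′ ∅) _ _ (begin
    chain P ss f ∅ + chain P ss f′ ∅   ≡⟨ chain-+ P ss f f′ ∅ ⟨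
    chain P ss (λ I → f I + f′ I) ∅    ≡⟨ h ⟩
    chain Q ss (λ I → g I + g′ I) ∅    ≡⟨ chain-+ Q ss g g′ ∅ ⟩
    chain Q ss g ∅ + chain Q ss g′ ∅   ≡⟨ cong (chain Q ss g ∅ +_) h′ ⟨
    chain Q ss g ∅ + chain P ss f′ ∅   ∎))

  agree-weight : ∀ {ss f g} (φ : ℕ → ℤ) → Agree ss f g → Agree ss (λ I → φ (size I) * f I) (λ I → φ (size I) * g I)
  agree-weight {ss} {f} {g} φ (agree h) = agree (begin
    chain P ss (λ I → φ (size I) * f I) ∅                ≡⟨ chain-weight P ss φ f ∅ ⟩
    φ (size (∅ {n}) ℕ.+ sum ss) * chain P ss f ∅          ≡⟨ cong₂ (λ z y → φ (z ℕ.+ sum ss) * y) (trans (size-∅ {n}) (sym (size-∅ {m}))) h ⟩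
    φ (size (∅ {m}) ℕ.+ sum ss) * chain Q ss g ∅          ≡⟨ chain-weight Q ss φ g ∅ ⟨
    chain Q ss (λ I → φ (size I) * g I) ∅                ∎)

  matched-UpBy : ∀ t {f g} → Matched f g → Matched (UpBy P t f) (UpBy Q t g)
  matched-UpBy t {f} {g} h ss = agree (trans (sym (chain-++ P ss t f ∅))
    (trans (agreement (h (ss ++ [ t ]))) (chain-++ Q ss t g ∅)))

  matched-Up : ∀ {f g} → Matched f g → Matched (Up P f) (Up Q g)
  matched-Up {f} {g} h ss = agree-resp
    (λ I _ → sym (Up-graded P (ℕP.m≤m+n n m) f I)) (λ I _ → sym (Up-graded Q (ℕP.m≤n+m m n) g I))
    (agree-∑ (upTo (suc N)) (λ s → UpBy P s f) (λ s → UpBy Q s g) (λ s _ → matched-UpBy s h ss))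

  matched-atSize : ∀ k {f g} → Matched f g → Matched (atSize k f) (atSize k g)
  matched-atSize k h ss = agree-weight (λ z → ⟦ z ℕ.≟ k ⟧) (h ss)

  matched-signedUp : ∀ k {f g} → Matched f g → Matched (signedUp P k f) (signedUp Q k g)
  matched-signedUp k {f} {g} h ss =
    agree-weight sgn (matched-Up (matched-atSize k (λ ss → agree-weight sgn (h ss))) ss)

  -- Strong induction on the level. In `Anti-level` the left side is matched by restriction to a
  -- size, and the lower terms by induction applied to `signedUp k`, which preserves matching.
  matched-Anti-level : ∀ k → Acc ℕ._<_ k → ∀ {f g} → Matched f g → Matched (Anti P (atSize k f)) (Anti Q (atSize k g))
  matched-Anti-level k (acc rec) {f} {g} h ss = agree-cancel
    (agree-resp (Anti-level P k f) (Anti-level Q k g) (matched-atSize k h ss))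
    (agree-∑ (upTo k) (λ j → Anti P (atSize j (signedUp P k f))) (λ j → Anti Q (atSize j (signedUp Q k g)))
      (λ j j∈ → matched-Anti-level j (rec (∈-upTo⁻ j∈)) (matched-signedUp k h) ss))

  -- The target level `size I + s` varies with `I`, so the function is first split by the size of
  -- `I`; on each piece the level is fixed.
  matched-AntiBy : ∀ s {f g} → Matched f g → Matched (AntiBy P s f) (AntiBy Q s g)
  matched-AntiBy s {f} {g} h ss = agree-resp
    (λ I _ → ∑-upTo-select (size I) (λ k → Anti P (atSize (k ℕ.+ s) f) I) (ℕ.s≤s (ℕP.≤-trans (size≤n P I) (ℕP.m≤m+n n m))))
    (λ I _ → ∑-upTo-select (size I) (λ k → Anti Q (atSize (k ℕ.+ s) g) I) (ℕ.s≤s (ℕP.≤-trans (size≤n Q I) (ℕP.m≤n+m m n))))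
    (agree-∑ (upTo (suc N)) (λ k → atSize k (Anti P (atSize (k ℕ.+ s) f))) (λ k → atSize k (Anti Q (atSize (k ℕ.+ s) g)))
      (λ k _ → matched-atSize k (matched-Anti-level (k ℕ.+ s) (ℕI.<-wellFounded (k ℕ.+ s)) h) ss))

  -- Unitriangularity of binomial coefficients: [X = i] is recovered from C(X,i) and all [X = j] with j > i.
  agree-level : ∀ {ss} (X : Vec Bool n → ℕ) (Y : Vec Bool m → ℕ) {f : Vec Bool n → ℤ} {g : Vec Bool m → ℤ} →
    (∀ I → X I ℕ.≤ N) → (∀ I → Y I ℕ.≤ N) →
    (∀ s → Agree ss (λ I → pos (X I C s) * f I) (λ I → pos (Y I C s) * g I)) →
    ∀ i → Agree ss (λ I → ⟦ X I ℕ.≟ i ⟧ * f I) (λ I → ⟦ Y I ℕ.≟ i ⟧ * g I)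
  agree-level {ss} X Y {f} {g} X≤N Y≤N h i = go (suc N) i (ℕP.m≤n+m (suc N) i)
    where
    expand : ∀ x i y → x ℕ.≤ N → pos (x C i) * y ≡
      ⟦ x ℕ.≟ i ⟧ * y + ∑ (upTo N) (λ e → pos ((suc i ℕ.+ e) C i) * (⟦ x ℕ.≟ suc i ℕ.+ e ⟧ * y))
    expand x i y x≤N = begin
      pos (x C i) * y
        ≡⟨ cong (_* y) (C-inversion x i x≤N) ⟩
      (⟦ x ℕ.≟ i ⟧ + ∑ (upTo N) c) * y
        ≡⟨ ℤP.*-distribʳ-+ y ⟦ x ℕ.≟ i ⟧ (∑ (upTo N) c) ⟩
      ⟦ x ℕ.≟ i ⟧ * y + ∑ (upTo N) c * y
        ≡⟨ cong (⟦ x ℕ.≟ i ⟧ * y +_) (trans (sym (∑-*ʳ (upTo N) c y))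
             (∑-cong (upTo N) λ e → ℤP.*-assoc (pos ((suc i ℕ.+ e) C i)) ⟦ x ℕ.≟ suc i ℕ.+ e ⟧ y)) ⟩
      ⟦ x ℕ.≟ i ⟧ * y + ∑ (upTo N) (λ e → pos ((suc i ℕ.+ e) C i) * (⟦ x ℕ.≟ suc i ℕ.+ e ⟧ * y)) ∎
      where
      c : ℕ → ℤ
      c e = pos ((suc i ℕ.+ e) C i) * ⟦ x ℕ.≟ suc i ℕ.+ e ⟧
    -- Downward induction on `i`, with `d` as the remaining distance. Once `i` exceeds `N` both
    -- indicators vanish, and the empty sum supplies the agreement of the zero functions.
    go : ∀ d i → N ℕ.< i ℕ.+ d → Agree ss (λ I → ⟦ X I ℕ.≟ i ⟧ * f I) (λ I → ⟦ Y I ℕ.≟ i ⟧ * g I)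
    go zero i N<i = agree-resp (λ I _ → vanish (X I) (f I) (X≤N I)) (λ I _ → vanish (Y I) (g I) (Y≤N I))
      (agree-∑ {A = ℕ} [] (λ _ _ → 0ℤ) (λ _ _ → 0ℤ) (λ _ ()))
      where
      vanish : ∀ x y → x ℕ.≤ N → 0ℤ ≡ ⟦ x ℕ.≟ i ⟧ * y
      vanish x y x≤N = sym (⟦⟧*-zero (x ℕ.≟ i) λ x≡i →
        contradiction x≡i (ℕP.<⇒≢ (ℕP.≤-<-trans x≤N (subst (N ℕ.<_) (ℕP.+-identityʳ i) N<i))))
    go (suc d) i N<i+1+d = agree-cancel
      (agree-resp (λ I _ → expand (X I) i (f I) (X≤N I)) (λ I _ → expand (Y I) i (g I) (Y≤N I)) (h i))
      (agree-∑ (upTo N)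
        (λ e I → pos ((suc i ℕ.+ e) C i) * (⟦ X I ℕ.≟ suc i ℕ.+ e ⟧ * f I))
        (λ e I → pos ((suc i ℕ.+ e) C i) * (⟦ Y I ℕ.≟ suc i ℕ.+ e ⟧ * g I))
        (λ e _ → agree-weight (λ _ → pos ((suc i ℕ.+ e) C i)) (go d (suc i ℕ.+ e) (bound e))))
      where
      bound : ∀ e → N ℕ.< (suc i ℕ.+ e) ℕ.+ d
      bound e = ℕP.<-≤-trans N<i+1+d (subst (ℕ._≤ (suc i ℕ.+ e) ℕ.+ d) (sym (ℕP.+-suc i d))
        (ℕP.+-monoˡ-≤ d (ℕP.m≤m+n (suc i) e)))

  -- Binomial inversion is used twice. The indicator of `minOut` is obtained first, over all chains,
  -- from antichain steps applied to the constant 1; it then serves as the function in `UpBy-maxIn`,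
  -- which yields the indicator of `maxIn`.
  agree-anti : Matched (λ _ → 1ℤ) (λ _ → 1ℤ) → ∀ k i j →
    Agree [ k ] (λ I → ⟦ maxIn P I ℕ.≟ i ⟧ * (⟦ minOut P I ℕ.≟ j ⟧ * 1ℤ))
                (λ I → ⟦ maxIn Q I ℕ.≟ i ⟧ * (⟦ minOut Q I ℕ.≟ j ⟧ * 1ℤ))
  agree-anti one k i j = agree-level (maxIn P) (maxIn Q) {f} {g}
    (λ I → ℕP.≤-trans (count≤n (isMaxIn? P I)) (ℕP.m≤m+n n m))
    (λ I → ℕP.≤-trans (count≤n (isMaxIn? Q I)) (ℕP.m≤n+m m n))
    (λ s → agree (trans (UpBy-maxIn P k s f)
      (trans (agreement (matched-Up (matched-AntiBy s (matched-atSize k {f} {g} matched-minOut)) [])) (sym (UpBy-maxIn Q k s g)))))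
    i
    where
    f : Vec Bool n → ℤ
    f I = ⟦ minOut P I ℕ.≟ j ⟧ * 1ℤ
    g : Vec Bool m → ℤ
    g I = ⟦ minOut Q I ℕ.≟ j ⟧ * 1ℤ
    matched-minOut : Matched f g
    matched-minOut ss = agree-level (minOut P) (minOut Q) {λ _ → 1ℤ} {λ _ → 1ℤ}
      (λ I → ℕP.≤-trans (count≤n (isMinOutside? P I)) (ℕP.m≤m+n n m))
      (λ I → ℕP.≤-trans (count≤n (isMinOutside? Q I)) (ℕP.m≤n+m m n))
      (λ t → agree-resp
        (λ I _ → trans (∑-antichains P I t) (sym (ℤP.*-identityʳ (pos (minOut P I C t)))))
        (λ I _ → trans (∑-antichains Q I t) (sym (ℤP.*-identityʳ (pos (minOut Q I C t)))))
        (matched-AntiBy t one ss))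
      j

-- P-partitions as chains of order ideals

isZero : ∀ {r} → Fin (suc r) → Bool
isZero zero    = true
isZero (suc _) = false

zeros : ∀ {n r} → Vec (Fin (suc r)) n → Vec Bool n
zeros = mapᵥ isZero

∈-zeros⁻ : ∀ {n r} (σ : Vec (Fin (suc r)) n) x → x ∈ₛ zeros σ → lookup σ x ≡ zero
∈-zeros⁻ σ x x∈Z with lookup σ x | trans (sym (VecP.lookup-map x isZero σ)) x∈Z
... | zero | _ = refl

∈-zeros⁺ : ∀ {n r} (σ : Vec (Fin (suc r)) n) x → lookup σ x ≡ zero → x ∈ₛ zeros σ
∈-zeros⁺ σ x eq = trans (VecP.lookup-map x isZero σ) (cong isZero eq)

-- A chain starting at J is a chain starting at the next ideal zeros τ ⊇ J, with levels shifted outside J.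
raise : ∀ {r} → Bool → Fin (suc r) → Fin (suc (suc r))
raise true  _ = zero
raise false c = suc c

zeros-raise : ∀ {n r} (J : Vec Bool n) (τ : Vec (Fin (suc r)) n) → zeros (zipWith raise J τ) ≡ J
zeros-raise []ᵥ          []ᵥ      = refl
zeros-raise (true  ∷ᵥ J) (c ∷ᵥ τ) = cong (true ∷ᵥ_) (zeros-raise J τ)
zeros-raise (false ∷ᵥ J) (c ∷ᵥ τ) = cong (false ∷ᵥ_) (zeros-raise J τ)

∑-raise-Fin : ∀ r (g : Fin (suc (suc r)) → ℤ) → ∑ (allFin (suc (suc r))) g ≡
  ∑ (true ∷ false ∷ []) λ b → ∑ (allFin (suc r)) λ c →
    ⟦ (b Bool.≟ true) →-dec (isZero c Bool.≟ true) ⟧ * g (raise b c)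
∑-raise-Fin r g = cong₂ _+_ (sym head) (trans (∑-tabulate suc g) (sym tail))
  where
  head : ∑ (allFin (suc r)) (λ c → ⟦ (true Bool.≟ true) →-dec (isZero c Bool.≟ true) ⟧ * g zero) ≡ g zero
  head = trans (cong₂ _+_ (ℤP.*-identityˡ (g zero))
    (trans (∑-tabulate {n = r} suc (λ c → ⟦ (true Bool.≟ true) →-dec (isZero c Bool.≟ true) ⟧ * g zero))
      (∑-zero (allFin r) (λ _ → refl))))
    (ℤP.+-identityʳ (g zero))
  tail : ∑ (allFin (suc r)) (λ c → ⟦ (false Bool.≟ true) →-dec (isZero c Bool.≟ true) ⟧ * g (suc c)) + 0ℤ
       ≡ ∑ (allFin (suc r)) (g ∘ suc)
  tail = trans (ℤP.+-identityʳ _) (∑-cong (allFin (suc r)) λ c → ℤP.*-identityˡ (g (suc c)))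

-- Each map `σ` is raised from exactly one admissible pair: `J` is its zero set, and `τ` lowers the
-- positive values by one. The code of a single value is applied coordinate by coordinate.
∑-raise : ∀ r n (f : Vec (Fin (suc (suc r))) n → ℤ) → ∑ (allVecs n (allFin (suc (suc r)))) f ≡
  ∑ (𝒫 n) λ J → ∑ (allVecs n (allFin (suc r))) λ τ → ⟦ J ⊆? zeros τ ⟧ * f (zipWith raise J τ)
∑-raise r zero f = sym (trans (ℤP.+-identityʳ _)
  (cong (_+ 0ℤ) (⟦⟧*-yes (_⊆?_ {zero} []ᵥ []ᵥ) {f []ᵥ} (λ ()))))
∑-raise r (suc n) f = begin
  ∑ (allVecs (suc n) (allFin (suc (suc r)))) f
    ≡⟨ ∑-allVecs-suc (allFin (suc (suc r))) n f ⟩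
  ∑ (allFin (suc (suc r))) (λ c → ∑ (allVecs n (allFin (suc (suc r)))) (λ σ → f (c ∷ᵥ σ)))
    ≡⟨ ∑-raise-Fin r (λ c → ∑ (allVecs n (allFin (suc (suc r)))) (λ σ → f (c ∷ᵥ σ))) ⟩
  ∑ (true ∷ false ∷ []) (λ b → ∑ (allFin (suc r)) (λ c →
    ⟦ zero? b c ⟧ * ∑ (allVecs n (allFin (suc (suc r)))) (λ σ → f (raise b c ∷ᵥ σ))))
    ≡⟨ ∑-cong (true ∷ false ∷ []) (λ b → ∑-cong (allFin (suc r)) (λ c → step b c)) ⟩
  ∑ (true ∷ false ∷ []) (λ b → ∑ (allFin (suc r)) (λ c → ∑ (𝒫 n) (λ J → ∑ V (λ τ → term b c J τ))))
    ≡⟨ ∑-cong (true ∷ false ∷ []) (λ b → ∑-swap (allFin (suc r)) (𝒫 n) (λ c J → ∑ V (λ τ → term b c J τ))) ⟩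
  ∑ (true ∷ false ∷ []) (λ b → ∑ (𝒫 n) (λ J → ∑ (allFin (suc r)) (λ c → ∑ V (λ τ → term b c J τ))))
    ≡⟨ ∑-cong (true ∷ false ∷ []) (λ b → ∑-cong (𝒫 n) (λ J →
         ∑-allVecs-suc (allFin (suc r)) n (λ τ → ⟦ (b ∷ᵥ J) ⊆? zeros τ ⟧ * f (zipWith raise (b ∷ᵥ J) τ)))) ⟨
  ∑ (true ∷ false ∷ []) (λ b → ∑ (𝒫 n) (λ J → inner (b ∷ᵥ J)))
    ≡⟨ ∑-allVecs-suc (true ∷ false ∷ []) n inner ⟨
  ∑ (𝒫 (suc n)) inner ∎
  where
  V = allVecs n (allFin (suc r))
  zero? : (b : Bool) (c : Fin (suc r)) → Dec (b ≡ true → isZero c ≡ true)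
  zero? b c = (b Bool.≟ true) →-dec (isZero c Bool.≟ true)
  inner : Vec Bool (suc n) → ℤ
  inner J = ∑ (allVecs (suc n) (allFin (suc r))) (λ τ → ⟦ J ⊆? zeros τ ⟧ * f (zipWith raise J τ))
  term : Bool → Fin (suc r) → Vec Bool n → Vec (Fin (suc r)) n → ℤ
  term b c J τ = ⟦ (b ∷ᵥ J) ⊆? zeros (c ∷ᵥ τ) ⟧ * f (raise b c ∷ᵥ zipWith raise J τ)
  ⊆-cons : ∀ b c J τ → ⟦ (b ∷ᵥ J) ⊆? zeros (c ∷ᵥ τ) ⟧ ≡ ⟦ zero? b c ⟧ * ⟦ J ⊆? zeros τ ⟧
  ⊆-cons b c J τ = trans
    (⟦⟧-cong ((b ∷ᵥ J) ⊆? zeros (c ∷ᵥ τ)) (zero? b c ×-dec (J ⊆? zeros τ))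
      (λ h → h zero , h ∘ suc) (λ { (h , _) zero → h ; (_ , h) (suc x) → h x }))
    (⟦⟧-× (zero? b c) (J ⊆? zeros τ))
  step : ∀ b c → ⟦ zero? b c ⟧ * ∑ (allVecs n (allFin (suc (suc r)))) (λ σ → f (raise b c ∷ᵥ σ))
               ≡ ∑ (𝒫 n) (λ J → ∑ V (λ τ → term b c J τ))
  step b c = begin
    ⟦ zero? b c ⟧ * ∑ (allVecs n (allFin (suc (suc r)))) (λ σ → f (raise b c ∷ᵥ σ))
      ≡⟨ cong (⟦ zero? b c ⟧ *_) (∑-raise r n (λ σ → f (raise b c ∷ᵥ σ))) ⟩
    ⟦ zero? b c ⟧ * ∑ (𝒫 n) (λ J → ∑ V (old J))
      ≡⟨ ∑-*ˡ (𝒫 n) ⟦ zero? b c ⟧ (λ J → ∑ V (old J)) ⟨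
    ∑ (𝒫 n) (λ J → ⟦ zero? b c ⟧ * ∑ V (old J))
      ≡⟨ ∑-cong (𝒫 n) (λ J → trans (sym (∑-*ˡ V ⟦ zero? b c ⟧ (old J))) (∑-cong V λ τ →
           trans (sym (ℤP.*-assoc ⟦ zero? b c ⟧ ⟦ J ⊆? zeros τ ⟧ (f (raise b c ∷ᵥ zipWith raise J τ))))
                 (cong (_* f (raise b c ∷ᵥ zipWith raise J τ)) (sym (⊆-cons b c J τ))))) ⟩
    ∑ (𝒫 n) (λ J → ∑ V (λ τ → term b c J τ)) ∎
    where
    old : Vec Bool n → Vec (Fin (suc r)) n → ℤ
    old J τ = ⟦ J ⊆? zeros τ ⟧ * f (raise b c ∷ᵥ zipWith raise J τ)

∑-allVecs-1 : ∀ n (f : Vec (Fin 1) n → ℤ) → ∑ (allVecs n (allFin 1)) f ≡ f (replicate n zero)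
∑-allVecs-1 zero    f = ℤP.+-identityʳ (f []ᵥ)
∑-allVecs-1 (suc n) f = trans (∑-allVecs-suc (allFin 1) n f)
  (trans (ℤP.+-identityʳ _) (∑-allVecs-1 n (λ v → f (zero ∷ᵥ v))))

_≟ₛ_ : ∀ {n} (I L : Vec Bool n) → Dec (I ≡ L)
_≟ₛ_ = VecP.≡-dec Bool._≟_

-- The value zero is left out, since its multiplicity is fixed by the ideal at which the chain
-- starts.
HasContent⁺ : ∀ {n r} → (Fin r → ℕ) → Vec (Fin (suc r)) n → Set
HasContent⁺ a σ = ∀ c → countFin (λ x → lookup σ x FinP.≟ suc c) ≡ a c

hasContent⁺? : ∀ {n r} (a : Fin r → ℕ) (σ : Vec (Fin (suc r)) n) → Dec (HasContent⁺ a σ)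
hasContent⁺? a σ = FinP.all? λ c → countFin (λ x → lookup σ x FinP.≟ suc c) ℕ.≟ a c

-- Level zero of a P-partition marks the ideal at which a chain starts, so weight 0 there forces ∅.
no-zeros : ∀ {r} → (Fin r → ℕ) → Fin (suc r) → ℕ
no-zeros a zero    = 0
no-zeros a (suc c) = a c

module _ {n : ℕ} (P : NLPoset n) where

  Extends : ∀ {r} → Vec Bool n → (Fin r → ℕ) → Vec (Fin (suc r)) n → Set
  Extends I a σ = IsPPartition P σ × zeros σ ≡ I × HasContent⁺ a σ

  extends? : ∀ {r} I (a : Fin r → ℕ) σ → Dec (Extends I a σ)
  extends? I a σ = isPPartition? P σ ×-dec ((zeros σ ≟ₛ I) ×-dec hasContent⁺? a σ)

  extensions : ∀ r → (Fin r → ℕ) → Vec Bool n → ℤ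
  extensions r a I = ∑ (allVecs n (allFin (suc r))) λ σ → ⟦ extends? I a σ ⟧

  coeffK-extensions : ∀ {r} (a : Fin r → ℕ) → pos (coeffK P (no-zeros a)) ≡ extensions r a ∅
  coeffK-extensions {r} a = trans
    (length-filter (λ σ → isPPartition? P σ ×-dec hasContent? (no-zeros a) σ) (allVecs n (allFin (suc r))))
    (∑-cong (allVecs n (allFin (suc r))) λ σ →
      ⟦⟧-cong (isPPartition? P σ ×-dec hasContent? (no-zeros a) σ) (extends? ∅ a σ)
        (λ (pp , h) → pp , zeros≡∅ σ (h zero) , h ∘ suc)
        (λ (pp , z , h) → pp , λ { zero → no-zero σ z ; (suc c) → h c }))
    where
    zeros≡∅ : ∀ (σ : Vec (Fin (suc r)) n) → countFin (λ x → lookup σ x FinP.≟ zero) ≡ 0 → zeros σ ≡ ∅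
    zeros≡∅ σ h = ⊆-antisym (zeros σ) ∅
      (λ x x∈Z → contradiction (∈-zeros⁻ σ x x∈Z) (count-zero⁻ (λ x → lookup σ x FinP.≟ zero) h x))
      (λ x x∈∅ → contradiction x∈∅ (x∉∅ x))
    no-zero : ∀ (σ : Vec (Fin (suc r)) n) → zeros σ ≡ ∅ → countFin (λ x → lookup σ x FinP.≟ zero) ≡ 0
    no-zero σ z = count-zero (λ x → lookup σ x FinP.≟ zero) λ x eq →
      x∉∅ x (subst (x ∈ₛ_) z (∈-zeros⁺ σ x eq))

  zeros-ideal : ∀ {r} (τ : Vec (Fin (suc r)) n) → IsPPartition P τ → IsOrderIdeal P (zeros τ)
  zeros-ideal τ pp x y x∈Z y≼x = ∈-zeros⁺ τ y (FinP.toℕ-injective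
    (ℕP.n≤0⇒n≡0 (subst (toℕ (lookup τ y) ℕ.≤_) (cong toℕ (∈-zeros⁻ τ x x∈Z)) (pp y x y≼x))))

  module _ {r : ℕ} (I : Vec Bool n) (idI : IsOrderIdeal P I) (τ : Vec (Fin (suc r)) n) (I⊆Z : I ⊆ zeros τ) where

    private
      σ = zipWith raise I τ

    lookup-σ : ∀ x → lookup σ x ≡ raise (lookup I x) (lookup τ x)
    lookup-σ x = VecP.lookup-zipWith raise x I τ

    raise-ppartition : IsPPartition P τ → IsPPartition P σ
    raise-ppartition pp x y x≼y = subst₂ Fin._≤_ (sym (lookup-σ x)) (sym (lookup-σ y)) (go (lookup I x) (lookup I y) refl refl)
      where
      go : ∀ b c → lookup I x ≡ b → lookup I y ≡ c → raise b (lookup τ x) Fin.≤ raise c (lookup τ y)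
      go true  c     x∈I y∈I = ℕ.z≤n
      go false true  x∉I y∈I = contradiction (idI y x y∈I x≼y) (∉ₛ⇒∉ I x∉I)
      go false false _   _   = ℕ.s≤s (pp x y x≼y)

    lower-ppartition : IsPPartition P σ → IsPPartition P τ
    lower-ppartition pp x y x≼y = go (lookup I x) (lookup I y) refl refl (subst₂ Fin._≤_ (lookup-σ x) (lookup-σ y) (pp x y x≼y))
      where
      zero-≤ : x ∈ₛ I → lookup τ x Fin.≤ lookup τ y
      zero-≤ x∈I = subst (Fin._≤ lookup τ y) (sym (∈-zeros⁻ τ x (I⊆Z x x∈I))) ℕ.z≤n
      go : ∀ b c → lookup I x ≡ b → lookup I y ≡ c →
        raise b (lookup τ x) Fin.≤ raise c (lookup τ y) → lookup τ x Fin.≤ lookup τ y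
      go true  c     x∈I _   _ = zero-≤ x∈I
      go false true  _   y∈I _ = zero-≤ (idI y x y∈I x≼y)
      go false false _   _   h = ℕ.s≤s⁻¹ h

    -- The elements of `σ` with value one are those that join the chain in its first step, from `I`
    -- to `zeros τ`.
    count-one : size (zeros τ) ≡ size I ℕ.+ countFin (λ x → lookup σ x FinP.≟ suc zero)
    count-one = count-⊎ (λ x → lookup I x Bool.≟ true) (λ x → lookup σ x FinP.≟ suc zero)
      (λ x → lookup (zeros τ) x Bool.≟ true) split I⊆Z
      (λ x eq → ∈-zeros⁺ τ x (one (lookup I x) (trans (sym (lookup-σ x)) eq)))
      (λ x x∈I eq → not-one (trans (sym (trans (lookup-σ x) (cong (λ b → raise b (lookup τ x)) x∈I))) eq))
      where
      one : ∀ b {c : Fin (suc r)} → raise b c ≡ suc zero → c ≡ zero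
      one false refl = refl
      not-one : zero ≢ suc {suc r} zero
      not-one ()
      split : ∀ x → x ∈ₛ zeros τ → x ∈ₛ I ⊎ lookup σ x ≡ suc zero
      split x x∈Z with lookup I x | lookup-σ x
      ... | true  | _  = inj₁ refl
      ... | false | eq = inj₂ (trans eq (cong suc (∈-zeros⁻ τ x x∈Z)))

    count-suc-suc : ∀ c → countFin (λ x → lookup σ x FinP.≟ suc (suc c)) ≡ countFin (λ x → lookup τ x FinP.≟ suc c)
    count-suc-suc c = count-cong (λ x → lookup σ x FinP.≟ suc (suc c)) (λ x → lookup τ x FinP.≟ suc c)
      (λ x eq → lower (lookup I x) (trans (sym (lookup-σ x)) eq))
      (λ x eq → trans (lookup-σ x) (upper x eq (lookup I x) refl))
      where
      lower : ∀ b {t : Fin (suc r)} → raise b t ≡ suc (suc c) → t ≡ suc c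
      lower false refl = refl
      upper : ∀ x → lookup τ x ≡ suc c → ∀ b → lookup I x ≡ b → raise b (lookup τ x) ≡ suc (suc c)
      upper x eq true  x∈I = contradiction (trans (sym (∈-zeros⁻ τ x (I⊆Z x x∈I))) eq) λ ()
      upper x eq false _   = cong suc eq

  -- Peeling off the first layer: the zero set of `σ` forces `J` to be `I`, and the zero set of the
  -- lowered map `τ` is the next ideal of the chain, larger by `a zero`.
  extensions-suc : ∀ r (a : Fin (suc r) → ℕ) →
    _≐_ P (extensions (suc r) a) (UpBy P (a zero) (extensions r (a ∘ suc)))
  extensions-suc r a I idI = begin
    ∑ (allVecs n (allFin (suc (suc r)))) (λ σ → ⟦ extends? I a σ ⟧)
      ≡⟨ ∑-raise r n (λ σ → ⟦ extends? I a σ ⟧) ⟩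
    ∑ (𝒫 n) (λ J → ∑ V (λ τ → ⟦ J ⊆? zeros τ ⟧ * ⟦ extends? I a (zipWith raise J τ) ⟧))
      ≡⟨ ∑-𝒫-single I _ (λ J J≢I → ∑-zero V (λ τ → ⟦⟧*-zero (J ⊆? zeros τ) (λ _ →
           ⟦⟧-no (extends? I a (zipWith raise J τ)) (λ (_ , z , _) → J≢I (trans (sym (zeros-raise J τ)) z))))) ⟩
    ∑ V (λ τ → ⟦ I ⊆? zeros τ ⟧ * ⟦ extends? I a (zipWith raise I τ) ⟧)
      ≡⟨ ∑-cong V pointwise ⟩
    ∑ V (λ τ → ⟦ above-by? P (a zero) I (zeros τ) ⟧ * ⟦ extends? (zeros τ) (a ∘ suc) τ ⟧)
      -- A sum over `L` is introduced in which only `L = zeros τ` contributes, so that the sums over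
      -- `τ` and `L` can be exchanged.
      ≡⟨ ∑-cong V (λ τ → ∑-𝒫-single (zeros τ) _ (λ L L≢Z → trans
           (ℤP.*-comm ⟦ above-by? P (a zero) I L ⟧ ⟦ extends? L (a ∘ suc) τ ⟧)
           (⟦⟧*-zero (extends? L (a ∘ suc) τ) (λ (_ , z , _) → contradiction (sym z) L≢Z)))) ⟨
    ∑ V (λ τ → ∑ (𝒫 n) (λ L → ⟦ above-by? P (a zero) I L ⟧ * ⟦ extends? L (a ∘ suc) τ ⟧))
      ≡⟨ ∑-linear V (𝒫 n) (λ L → ⟦ above-by? P (a zero) I L ⟧) (λ τ L → ⟦ extends? L (a ∘ suc) τ ⟧) ⟨
    ∑ (𝒫 n) (λ L → ⟦ above-by? P (a zero) I L ⟧ * ∑ V (λ τ → ⟦ extends? L (a ∘ suc) τ ⟧)) ∎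
    where
    V = allVecs n (allFin (suc r))
    to : ∀ τ → I ⊆ zeros τ × Extends I a (zipWith raise I τ) →
      (Above P I (zeros τ) × size (zeros τ) ≡ size I ℕ.+ a zero) × Extends (zeros τ) (a ∘ suc) τ
    to τ (I⊆Z , pp , _ , h) = ((zeros-ideal τ ppτ , I⊆Z) , trans (count-one I idI τ I⊆Z) (cong (size I ℕ.+_) (h zero))) ,
      ppτ , refl , λ c → trans (sym (count-suc-suc I idI τ I⊆Z c)) (h (suc c))
      where
      ppτ = lower-ppartition I idI τ I⊆Z pp
    from : ∀ τ → (Above P I (zeros τ) × size (zeros τ) ≡ size I ℕ.+ a zero) × Extends (zeros τ) (a ∘ suc) τ →
      I ⊆ zeros τ × Extends I a (zipWith raise I τ)
    from τ (((_ , I⊆Z) , eq) , pp , _ , h) = I⊆Z , raise-ppartition I idI τ I⊆Z pp , zeros-raise I τ ,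
      λ { zero    → ℕP.+-cancelˡ-≡ (size I) _ _ (trans (sym (count-one I idI τ I⊆Z)) eq)
        ; (suc c) → trans (count-suc-suc I idI τ I⊆Z c) (h c) }
    pointwise : ∀ τ → ⟦ I ⊆? zeros τ ⟧ * ⟦ extends? I a (zipWith raise I τ) ⟧
      ≡ ⟦ above-by? P (a zero) I (zeros τ) ⟧ * ⟦ extends? (zeros τ) (a ∘ suc) τ ⟧
    pointwise τ = trans (sym (⟦⟧-× (I ⊆? zeros τ) (extends? I a (zipWith raise I τ))))
      (trans (⟦⟧-cong ((I ⊆? zeros τ) ×-dec extends? I a (zipWith raise I τ))
                (above-by? P (a zero) I (zeros τ) ×-dec extends? (zeros τ) (a ∘ suc) τ) (to τ) (from τ))
             (⟦⟧-× (above-by? P (a zero) I (zeros τ)) (extends? (zeros τ) (a ∘ suc) τ)))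

  -- A P-partition assigns a value to every element, so its chain of sublevel sets must end at the
  -- whole poset.
  isFull : Vec Bool n → ℤ
  isFull I = ⟦ ⊤ₛ ≟ₛ I ⟧

  extensions-chain : ∀ r (a : Fin r → ℕ) → _≐_ P (extensions r a) (chain P (tabulate a) isFull)
  extensions-chain zero a I idI = trans (∑-allVecs-1 n (λ σ → ⟦ extends? I a σ ⟧))
    (⟦⟧-cong (extends? I a (replicate n zero)) (⊤ₛ ≟ₛ I)
      (λ (_ , z , _) → trans (sym zeros≡⊤) z)
      (λ eq → (λ x y _ → FinP.≤-reflexive (trans (VecP.lookup-replicate x zero) (sym (VecP.lookup-replicate y zero)))) ,
        trans zeros≡⊤ eq , λ ()))
    where
    zeros≡⊤ : zeros {r = zero} (replicate n zero) ≡ ⊤ₛ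
    zeros≡⊤ = VecP.map-replicate isZero zero n
  extensions-chain (suc r) a I idI = trans (extensions-suc r a I idI)
    (chain-cong P [ a zero ] (extensions-chain r (a ∘ suc)) I idI)

  -- Exactly one ideal above `I` is full. This lifts the condition that chains end at the whole
  -- poset.
  Up-isFull : ∀ I → Up P isFull I ≡ 1ℤ
  Up-isFull I = trans
    (∑-𝒫-single ⊤ₛ _ λ L L≢⊤ → ⟦⟧*-zero (above? P I L) λ _ → ⟦⟧-no (⊤ₛ ≟ₛ L) (≢-sym L≢⊤))
    (trans (⟦⟧*-yes (above? P I ⊤ₛ) ((λ _ y _ _ → x∈⊤ y) , λ x _ → x∈⊤ x)) (⟦⟧-yes (⊤ₛ {n} ≟ₛ ⊤ₛ) refl))

  anti-UpBy : ∀ k i j → pos (anti P k i j) ≡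
    UpBy P k (λ I → ⟦ maxIn P I ℕ.≟ i ⟧ * (⟦ minOut P I ℕ.≟ j ⟧ * 1ℤ)) ∅
  anti-UpBy k i j = trans (length-filter _ (𝒫 n)) (∑-cong (𝒫 n) λ I → let
      max? = maxIn P I ℕ.≟ i
      min? = minOut P I ℕ.≟ j in begin
    ⟦ isOrderIdeal? P I ×-dec ((size I ℕ.≟ k) ×-dec (max? ×-dec min?)) ⟧
      ≡⟨ ⟦⟧-cong (isOrderIdeal? P I ×-dec ((size I ℕ.≟ k) ×-dec (max? ×-dec min?)))
           (above-by? P k ∅ I ×-dec (max? ×-dec min?))
           (λ (idI , eq , h) → ((idI , λ x x∈∅ → contradiction x∈∅ (x∉∅ x)) , trans eq (cong (ℕ._+ k) (sym (size-∅ {n})))) , h)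
           (λ (((idI , _) , eq) , h) → idI , trans eq (cong (ℕ._+ k) (size-∅ {n})) , h) ⟩
    ⟦ above-by? P k ∅ I ×-dec (max? ×-dec min?) ⟧
      ≡⟨ ⟦⟧-× (above-by? P k ∅ I) (max? ×-dec min?) ⟩
    ⟦ above-by? P k ∅ I ⟧ * ⟦ max? ×-dec min? ⟧
      ≡⟨ cong (⟦ above-by? P k ∅ I ⟧ *_) (trans (⟦⟧-× max? min?) (cong (⟦ max? ⟧ *_) (sym (ℤP.*-identityʳ ⟦ min? ⟧)))) ⟩
    ⟦ above-by? P k ∅ I ⟧ * (⟦ max? ⟧ * (⟦ min? ⟧ * 1ℤ)) ∎)

-- From equal generating functions to equal antichain counts

sameK⇒matched-isFull : ∀ {n m} (P : NLPoset n) (Q : NLPoset m) → SameK P Q → Matched P Q (isFull P) (isFull Q)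
sameK⇒matched-isFull P Q sameK ss = subst (λ ss → Agree P Q ss (isFull P) (isFull Q)) (ListP.tabulate-lookup ss) (agree (begin
  chain P (tabulate a) (isFull P) ∅   ≡⟨ extensions-chain P (length ss) a ∅ (∅-ideal P) ⟨
  extensions P (length ss) a ∅        ≡⟨ coeffK-extensions P a ⟨
  -- The monomial has one extra variable of exponent 0, for the level that marks the start of the
  -- chain.
  pos (coeffK P (no-zeros a))         ≡⟨ cong pos (sameK (suc (length ss)) (no-zeros a)) ⟩
  pos (coeffK Q (no-zeros a))         ≡⟨ coeffK-extensions Q a ⟩
  extensions Q (length ss) a ∅        ≡⟨ extensions-chain Q (length ss) a ∅ (∅-ideal Q) ⟩
  chain Q (tabulate a) (isFull Q) ∅   ∎))
  where
  a = List.lookup ss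

theorem3p4 : ∀ {n m} (P : NLPoset n) (Q : NLPoset m) → SameK P Q →
    ∀ (k i j : ℕ) → anti P k i j ≡ anti Q k i j
theorem3p4 P Q sameK k i j = ℤP.+-injective (begin
  pos (anti P k i j)   ≡⟨ anti-UpBy P k i j ⟩
  _                    ≡⟨ Agree.agreement (agree-anti P Q one k i j) ⟩
  _                    ≡⟨ anti-UpBy Q k i j ⟨
  pos (anti Q k i j)   ∎)
  where
  one : Matched P Q (λ _ → 1ℤ) (λ _ → 1ℤ)
  one ss = agree-resp P Q (λ I _ → Up-isFull P I) (λ I _ → Up-isFull Q I)
    (matched-Up P Q {isFull P} {isFull Q} (sameK⇒matched-isFull P Q sameK) ss)
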